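{- Let $\mathcal{C}$ be a finite abstract simplicial complex and $\mathcal{M}$ a matroid on the same finite ground set $V$, and let $1\le k\le r(\mathcal{M})$ and $m\ge0$ be integers. If $\eta_H(\mathcal{C}[X])+r(\mathcal{M}[V\setminus X])\ge k+m$ for all $X\subseteq V$ for which $V\setminus X$ is a flat of $\mathcal{M}$ of rank at most $k-1$, then $\eta_H(\mathbf{Int}(\mathcal{C},\mathcal{M};k))\ge m+1$.
   Context: $\mathcal{C}[X]=\{\sigma\in\mathcal{C}:\sigma\subseteq X\}$, $\mathcal{M}[X]=\{A\in\mathcal{M}:A\subseteq X\}$, $r$ is matroid rank; a flat of $\mathcal{M}$ is $F\subseteq V$ with $r(\mathcal{M}[F\cup\{x\}])>r(\mathcal{M}[F])$ for all $x\in V\setminus F$. $\eta_H(\mathcal{K})$ is $2$ plus the largest $k\ge-2$ with $\widetilde H_j(\mathcal{K};\mathbb{Q})=0$ for all $-1\le j\le k$ ($\widetilde H_{ -1}=0$ meaning $\mathcal{K}$ has a vertex), possibly $\infty$. For a matroid $\mathcal{N}$ on $V$, $\mathbf{Int}(\mathcal{C},\mathcal{N})$ is the simplicial complex whose vertices are the simplices of $\mathcal{C}$ containing a basis of $\mathcal{N}$, and whose simplices are the chains $\sigma_1\subset\cdots\subset\sigma_\ell$ of such simplices. $\mathbf{Int}(\mathcal{C},\mathcal{M};k)=\mathbf{Int}(\mathcal{C},\mathcal{M}_{\le k})$, where $\mathcal{M}_{\le k}=\{A\in\mathcal{M}:|A|\le k\}$. -}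

module Defs where

open import Data.Bool.Properties as Bool using ()
open import Data.Empty using (⊥-elim)
open import Data.Fin using (Fin; zero; suc; toℕ; fromℕ<; inject)
open import Data.Fin.Properties as Fin using (all?; ¬∀⟶∃¬-smallest)
open import Data.Fin.Subset using (Subset; inside; outside; ⊥; ⁅_⁆; _∪_; ∁; ∣_∣; _∈_; _∉_; _⊆_)
open import Data.Fin.Subset.Properties using (_∈?_; _⊆?_; anySubset?; ∣p∣≤n; ⊆-trans; ⊆-min; x∈p∪q⁻; ∣⊥∣≡0; ∉⊥; x∈⁅y⁆⇒x≡y; ∪-identityʳ; p⊆q⇒∣p∣≤∣q∣)
open import Data.List using (List; []; _∷_; map; filter; length; lookup; _++_)
open import Data.List.Extrema.Nat using (max)
import Data.List.Membership.Propositional as List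
open import Data.List.Membership.Propositional.Properties using (∈-map⁺; ∈-map⁻; ∈-++⁺ˡ; ∈-++⁺ʳ)
open import Data.List.Relation.Unary.All as All using (All; []; _∷_)
import Data.List.Relation.Unary.All.Properties as All
open import Data.List.Relation.Unary.Any as Any using (Any; here; there)
open import Data.List.Relation.Unary.Unique.Propositional using (Unique; []; _∷_)
import Data.List.Relation.Unary.Unique.Propositional.Properties as Unique
open import Data.Maybe using (Maybe; just; nothing)
import Data.Maybe.Properties as Maybe
open import Data.Nat using (ℕ; zero; suc; _+_; _∸_; _≤_; _<_; z≤n; s≤s; _≤?_)
import Data.Nat.Properties as ℕ
open import Data.Product using (∃; _×_; _,_; proj₁; proj₂)
open import Data.Rational as ℚ using (ℚ; 0ℚ; 1ℚ)
import Data.Rational.Properties as ℚ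
open import Data.Rational.Solver using (module +-*-Solver)
open import Data.Sum using (_⊎_; inj₁; inj₂; [_,_]′)
open import Data.Vec using ([]; _∷_)
import Data.Vec.Properties as Vec
open import Function using (_∘_)
open import Function.Bundles using (_⇔_; mk⇔)
open import Relation.Binary.Definitions using (DecidableEquality)
open import Relation.Binary.PropositionalEquality using (_≡_; _≢_; _≗_; refl; sym; trans; cong; cong₂; subst; module ≡-Reasoning)
open import Relation.Nullary using (¬_; Dec; yes; no; contradiction)
open import Relation.Nullary.Construct.Add.Supremum using (_⁺; [_]; ⊤⁺)
open import Relation.Nullary.Decidable as Dec using (_×-dec_; _→-dec_; _⊎-dec_; ¬?; decidable-stable)
open import Relation.Unary using (Pred; Decidable)
import Relation.Binary.Construct.Add.Supremum.NonStrict as AddSup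
open import Algebra.Bundles using (CommutativeRing)
open import Algebra.Properties.CommutativeMonoid.Sum ℚ.+-0-commutativeMonoid using (sum; sum-cong-≗; ∑-distrib-+)
open import Algebra.Properties.Semiring.Sum (CommutativeRing.semiring ℚ.+-*-commutativeRing) using (*-distribˡ-sum)
open import Level using (0ℓ)

open +-*-Solver using (solve; _:=_; _:+_; _:*_; :-_; con)

------------------------------------------------------------------------
-- Simplicial complexes

-- The ground set is Fin n. A point v of it need not be a vertex, i.e. ⁅ v ⁆
-- need not be a face. The empty set is always a face.
record Complex (n : ℕ) : Set₁ where
  field
    Face        : Pred (Subset n) 0ℓ
    face?       : Decidable Face
    ∅-face      : Face ⊥
    down-closed : ∀ {σ τ} → σ ⊆ τ → Face τ → Face σ

open Complex public

infixl 8 _↾_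

_↾_ : ∀ {n} → Complex n → Subset n → Complex n
(C ↾ X) .Face σ = Face C σ × σ ⊆ X
(C ↾ X) .face? σ = face? C σ ×-dec (σ ⊆? X)
(C ↾ X) .∅-face = ∅-face C , ⊆-min X
(C ↾ X) .down-closed σ⊆τ (τ∈C , τ⊆X) = down-closed C σ⊆τ τ∈C , ⊆-trans σ⊆τ τ⊆X

------------------------------------------------------------------------
-- Enumeration of subsets

subsets : ∀ n → List (Subset n)
subsets zero    = [] ∷ []
subsets (suc n) = map (outside ∷_) (subsets n) ++ map (inside ∷_) (subsets n)

∈-subsets : ∀ {n} (σ : Subset n) → σ List.∈ subsets n
∈-subsets []            = here refl
∈-subsets (outside ∷ σ) = ∈-++⁺ˡ (∈-map⁺ (outside ∷_) (∈-subsets σ))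
∈-subsets {suc n} (inside ∷ σ) = ∈-++⁺ʳ (map (outside ∷_) (subsets n)) (∈-map⁺ (inside ∷_) (∈-subsets σ))

subsets-unique : ∀ n → Unique (subsets n)
subsets-unique zero    = [] ∷ []
subsets-unique (suc n) = Unique.++⁺ (Unique.map⁺ Vec.∷-injectiveʳ (subsets-unique n))
                                    (Unique.map⁺ Vec.∷-injectiveʳ (subsets-unique n)) disjoint
  where
  disjoint : ∀ {σ} → ¬ (σ List.∈ map (outside ∷_) (subsets n) × σ List.∈ map (inside ∷_) (subsets n))
  disjoint (p , q) with ∈-map⁻ (outside ∷_) p | ∈-map⁻ (inside ∷_) q
  ... | _ , _ , refl | _ , _ , ()

_≟ˢ_ : ∀ {n} → DecidableEquality (Subset n)
_≟ˢ_ = Vec.≡-dec Bool._≟_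

------------------------------------------------------------------------
-- Matroids

record Matroid (n : ℕ) : Set₁ where
  field
    independent : Complex n
    augment     : ∀ {A B} → Face independent A → Face independent B → ∣ A ∣ < ∣ B ∣ →
                  ∃ λ x → x ∈ B × x ∉ A × Face independent (A ∪ ⁅ x ⁆)

  Indep : Pred (Subset n) 0ℓ
  Indep = Face independent

  indep? : Decidable Indep
  indep? = face? independent

open Matroid public

rank : ∀ {n} → Matroid n → ℕ
rank {n} M = max 0 (map ∣_∣ (filter (indep? M) (subsets n)))

infixl 8 _↾ᴹ_

_↾ᴹ_ : ∀ {n} → Matroid n → Subset n → Matroid n
(M ↾ᴹ X) .independent = independent M ↾ X
(M ↾ᴹ X) .augment {A} (A∈M , A⊆X) (B∈M , B⊆X) ∣A∣<∣B∣ with augment M A∈M B∈M ∣A∣<∣B∣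
... | x , x∈B , x∉A , Ax∈M = x , x∈B , x∉A , Ax∈M ,
  λ y∈Ax → [ A⊆X , (λ y∈x → B⊆X (subst (_∈ _) (sym (x∈⁅y⁆⇒x≡y x y∈x)) x∈B)) ]′ (x∈p∪q⁻ A ⁅ x ⁆ y∈Ax)

∣A∪⁅x⁆∣≤1+∣A∣ : ∀ {n} (A : Subset n) x → ∣ A ∪ ⁅ x ⁆ ∣ ≤ suc ∣ A ∣
∣A∪⁅x⁆∣≤1+∣A∣ (outside ∷ A) zero    = s≤s (ℕ.≤-reflexive (cong ∣_∣ (∪-identityʳ A)))
∣A∪⁅x⁆∣≤1+∣A∣ (inside  ∷ A) zero    = s≤s (ℕ.m≤n⇒m≤1+n (ℕ.≤-reflexive (cong ∣_∣ (∪-identityʳ A))))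
∣A∪⁅x⁆∣≤1+∣A∣ (outside ∷ A) (suc x) = ∣A∪⁅x⁆∣≤1+∣A∣ A x
∣A∪⁅x⁆∣≤1+∣A∣ (inside  ∷ A) (suc x) = s≤s (∣A∪⁅x⁆∣≤1+∣A∣ A x)

truncate : ∀ {n} → Matroid n → ℕ → Matroid n
truncate M k .independent .Face A = Indep M A × ∣ A ∣ ≤ k
truncate M k .independent .face? A = indep? M A ×-dec (∣ A ∣ ≤? k)
truncate {n} M k .independent .∅-face = ∅-face (independent M) , ℕ.≤-trans (ℕ.≤-reflexive (∣⊥∣≡0 n)) z≤n
truncate M k .independent .down-closed A⊆B (B∈M , ∣B∣≤k) =
  down-closed (independent M) A⊆B B∈M , ℕ.≤-trans (p⊆q⇒∣p∣≤∣q∣ A⊆B) ∣B∣≤k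
truncate M k .augment {A} (A∈M , _) (B∈M , ∣B∣≤k) ∣A∣<∣B∣ with augment M A∈M B∈M ∣A∣<∣B∣
... | x , x∈B , x∉A , Ax∈M =
  x , x∈B , x∉A , Ax∈M , ℕ.≤-trans (∣A∪⁅x⁆∣≤1+∣A∣ A x) (ℕ.≤-trans ∣A∣<∣B∣ ∣B∣≤k)

IsFlat : ∀ {n} → Matroid n → Pred (Subset n) 0ℓ
IsFlat M F = ∀ x → x ∉ F → rank (M ↾ᴹ F) < rank (M ↾ᴹ (F ∪ ⁅ x ⁆))

IsBasis : ∀ {n} → Matroid n → Pred (Subset n) 0ℓ
IsBasis M B = Indep M B × (∀ A → Indep M A → B ⊆ A → A ⊆ B)

ContainsBasis : ∀ {n} → Matroid n → Pred (Subset n) 0ℓ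
ContainsBasis M σ = ∃ λ B → IsBasis M B × B ⊆ σ

isBasis? : ∀ {n} (M : Matroid n) → Decidable (IsBasis M)
isBasis? {n} M B = indep? M B ×-dec Dec.map′ to from
    (¬? (anySubset? (λ A → indep? M A ×-dec (B ⊆? A) ×-dec ¬? (A ⊆? B))))
  where
  Larger : Pred (Subset n) 0ℓ
  Larger A = Indep M A × B ⊆ A × ¬ (A ⊆ B)
  to : ¬ ∃ Larger → ∀ A → Indep M A → B ⊆ A → A ⊆ B
  to none A A∈M B⊆A = decidable-stable (A ⊆? B) (λ A⊈B → none (A , A∈M , B⊆A , A⊈B))
  from : (∀ A → Indep M A → B ⊆ A → A ⊆ B) → ¬ ∃ Larger
  from maxl (A , A∈M , B⊆A , A⊈B) = A⊈B (maxl A A∈M B⊆A)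

containsBasis? : ∀ {n} (M : Matroid n) → Decidable (ContainsBasis M)
containsBasis? M σ = anySubset? (λ B → isBasis? M B ×-dec (B ⊆? σ))

------------------------------------------------------------------------
-- The complexes Int

-- Vertices are positions in the list; faces are the sets of positions whose
-- entries are pairwise comparable under inclusion.
chainComplex : ∀ {n} (P : List (Subset n)) → Complex (length P)
chainComplex P .Face S = ∀ i j → i ∈ S → j ∈ S → lookup P i ⊆ lookup P j ⊎ lookup P j ⊆ lookup P i
chainComplex P .face? S = all? λ i → all? λ j →
  (i ∈? S) →-dec ((j ∈? S) →-dec ((lookup P i ⊆? lookup P j) ⊎-dec (lookup P j ⊆? lookup P i)))
chainComplex P .∅-face i j i∈⊥ _ = ⊥-elim (∉⊥ i∈⊥)
chainComplex P .down-closed S⊆T T∈ i j i∈S j∈S = T∈ i j (S⊆T i∈S) (S⊆T j∈S)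

-- By subsets-unique, each simplex of C containing a basis of N occurs exactly
-- once, so pairwise comparable positions are chains under strict inclusion.
IntVertices : ∀ {n} → Complex n → Matroid n → List (Subset n)
IntVertices {n} C N = filter (λ σ → face? C σ ×-dec containsBasis? N σ) (subsets n)

Int : ∀ {n} (C : Complex n) (N : Matroid n) → Complex (length (IntVertices C N))
Int C N = chainComplex (IntVertices C N)

Int≤ : ∀ {n} (C : Complex n) (M : Matroid n) (k : ℕ) → Complex (length (IntVertices C (truncate M k)))
Int≤ C M k = Int C (truncate M k)

------------------------------------------------------------------------
-- Reduced simplicial homology over ℚ

-- sgn v τ = (-1)^#{ u ∈ τ ∣ u < v }
sgn : ∀ {n} → Fin n → Subset n → ℚ
sgn zero    _             = 1ℚ
sgn (suc v) (outside ∷ τ) = sgn v τ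
sgn (suc v) (inside  ∷ τ) = ℚ.- sgn v τ

-- A chain is given by its coefficients on the faces, each face being oriented
-- by the order of Fin n. The coefficient of τ in ∂ c collects, for each v ∉ τ,
-- the coefficient of τ ∪ ⁅ v ⁆ with the sign (-1)^(position of v in τ ∪ ⁅ v ⁆).
∂-term : ∀ {n} → (Subset n → ℚ) → Subset n → Fin n → ℚ
∂-term c τ v with v ∈? τ
... | yes _ = 0ℚ
... | no  _ = sgn v τ ℚ.* c (τ ∪ ⁅ v ⁆)

∂ : ∀ {n} → (Subset n → ℚ) → Subset n → ℚ
∂ c τ = sum (∂-term c τ)

-- Chains are graded by the number d of vertices, i.e. d is dimension + 1; the
-- empty face spans the chains with d = 0.
IsChain : ∀ {n} → Complex n → ℕ → Pred (Subset n → ℚ) 0ℓ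
IsChain K d c = ∀ σ → ¬ (Face K σ × ∣ σ ∣ ≡ d) → c σ ≡ 0ℚ

IsCycle : ∀ {n} → Complex n → ℕ → Pred (Subset n → ℚ) 0ℓ
IsCycle K d c = IsChain K d c × (∀ τ → ∂ c τ ≡ 0ℚ)

IsBoundary : ∀ {n} → Complex n → ℕ → Pred (Subset n → ℚ) 0ℓ
IsBoundary K d c = ∃ λ b → IsChain K (suc d) b × (∀ τ → ∂ b τ ≡ c τ)

-- H̃≡0 K d states that the reduced homology of K in dimension d - 1 vanishes.
-- For d = 0 this says that K has a vertex, since the empty face is a cycle.
H̃≡0 : ∀ {n} → Complex n → ℕ → Set
H̃≡0 K d = ∀ c → IsCycle K d c → IsBoundary K d c

------------------------------------------------------------------------
-- Linear algebra over ℚ, used only to decide H̃≡0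

a0+0≡0 : ∀ a → a ℚ.* 0ℚ ℚ.+ 0ℚ ≡ 0ℚ
a0+0≡0 a = trans (ℚ.+-identityʳ _) (ℚ.*-zeroʳ a)

module LinearAlgebra {I : Set} where

  V : Set
  V = I → ℚ

  _≗_⊙_⊕_ : V → ℚ → V → V → Set
  v ≗ a ⊙ g ⊕ u = ∀ i → v i ≡ a ℚ.* g i ℚ.+ u i

  Linear : (V → ℚ) → Set
  Linear f = ∀ {v} a {g u} → v ≗ a ⊙ g ⊕ u → f v ≡ a ℚ.* f g ℚ.+ f u

  data Span (G : List V) : V → Set where
    nil  : ∀ {v} → (∀ i → v i ≡ 0ℚ) → Span G v
    step : ∀ {v} a {g u} → g List.∈ G → Span G u → v ≗ a ⊙ g ⊕ u → Span G v

  record Subspace (P : V → Set) : Set where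
    field
      zero∈ : ∀ {v} → (∀ i → v i ≡ 0ℚ) → P v
      comb∈ : ∀ {v} a {g u} → P g → P u → v ≗ a ⊙ g ⊕ u → P v

  span⊆ : ∀ {G P} → Subspace P → All P G → ∀ {v} → Span G v → P v
  span⊆ S PG (nil v≗0)         = Subspace.zero∈ S v≗0
  span⊆ S PG (step a g∈G s eq) = Subspace.comb∈ S a (All.lookup PG g∈G) (span⊆ S PG s) eq

  linear-0 : ∀ {f} → Linear f → ∀ {v} → (∀ i → v i ≡ 0ℚ) → f v ≡ 0ℚ
  linear-0 {f} lin {v} v≗0 = trans
    (lin (ℚ.- 1ℚ) {v} {v} (λ i → trans (v≗0 i) (sym (cancel (v i)))))
    (cancel (f v))
    where
    cancel : ∀ x → ℚ.- 1ℚ ℚ.* x ℚ.+ x ≡ 0ℚ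
    cancel = solve 1 (λ x → (:- con 1ℚ) :* x :+ x := con 0ℚ) refl

  ker-subspace : ∀ {f} → Linear f → Subspace (λ v → f v ≡ 0ℚ)
  ker-subspace lin = record
    { zero∈ = linear-0 lin
    ; comb∈ = λ a fg fu eq → trans (lin a eq) (trans (cong₂ (λ x y → a ℚ.* x ℚ.+ y) fg fu)
               (a0+0≡0 a))
    }

  ∩-subspace : ∀ {P Q} → Subspace P → Subspace Q → Subspace (λ v → P v × Q v)
  ∩-subspace S T = record
    { zero∈ = λ z → Subspace.zero∈ S z , Subspace.zero∈ T z
    ; comb∈ = λ a (p , q) (p′ , q′) eq → Subspace.comb∈ S a p p′ eq , Subspace.comb∈ T a q q′ eq
    }

  FinGen : (V → Set) → Set
  FinGen P = ∃ λ G → All P G × (∀ {v} → P v → Span G v)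

  module _ {P : V → Set} (S : Subspace P) {f : V → ℚ} (lin : Linear f) where

    module Pivot (G : List V) (PG : All P G) {g₀ : V} (g₀∈G : g₀ List.∈ G) (fg₀≢0 : f g₀ ≢ 0ℚ) where

      instance
        nz : ℚ.NonZero (f g₀)
        nz = ℚ.≢-nonZero fg₀≢0

      coef : V → ℚ
      coef v = ℚ.- (f v ℚ.* ℚ.1/ f g₀)

      π : V → V
      π v i = coef v ℚ.* g₀ i ℚ.+ v i

      fπ : ∀ v → f (π v) ≡ 0ℚ
      fπ v = begin
        f (π v)                                            ≡⟨ lin (coef v) {g₀} {v} (λ _ → refl) ⟩
        coef v ℚ.* f g₀ ℚ.+ f v                            ≡⟨ rearr (f v) (ℚ.1/ f g₀) (f g₀) ⟩
        ℚ.- (f v ℚ.* (ℚ.1/ f g₀ ℚ.* f g₀)) ℚ.+ f v         ≡⟨ cong (λ x → ℚ.- (f v ℚ.* x) ℚ.+ f v) (ℚ.*-inverseˡ (f g₀)) ⟩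
        ℚ.- (f v ℚ.* 1ℚ) ℚ.+ f v                           ≡⟨ cancel (f v) ⟩
        0ℚ                                                 ∎
        where
        open ≡-Reasoning
        rearr : ∀ x y z → ℚ.- (x ℚ.* y) ℚ.* z ℚ.+ x ≡ ℚ.- (x ℚ.* (y ℚ.* z)) ℚ.+ x
        rearr = solve 3 (λ x y z → (:- (x :* y)) :* z :+ x := (:- (x :* (y :* z))) :+ x) refl
        cancel : ∀ x → ℚ.- (x ℚ.* 1ℚ) ℚ.+ x ≡ 0ℚ
        cancel = solve 1 (λ x → (:- (x :* con 1ℚ)) :+ x := con 0ℚ) refl

      Pπ : ∀ {v} → P v → P (π v)
      Pπ {v} Pv = Subspace.comb∈ S (coef v) (All.lookup PG g₀∈G) Pv (λ _ → refl)

      π-zero : ∀ {v} → f v ≡ 0ℚ → π v ≗ v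
      π-zero {v} fv≡0 i = trans (cong (λ x → ℚ.- (x ℚ.* ℚ.1/ f g₀) ℚ.* g₀ i ℚ.+ v i) fv≡0) (drop (ℚ.1/ f g₀) (g₀ i) (v i))
        where
        drop : ∀ x y z → ℚ.- (0ℚ ℚ.* x) ℚ.* y ℚ.+ z ≡ z
        drop = solve 3 (λ x y z → (:- (con 0ℚ :* x)) :* y :+ z := z) refl

      π-lin : ∀ {v} a {g u} → v ≗ a ⊙ g ⊕ u → π v ≗ a ⊙ π g ⊕ π u
      π-lin {v} a {g} {u} eq i = trans
        (cong₂ (λ x y → ℚ.- (x ℚ.* ℚ.1/ f g₀) ℚ.* g₀ i ℚ.+ y) (lin a eq) (eq i))
        (rearr a (f g) (f u) (ℚ.1/ f g₀) (g₀ i) (g i) (u i))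
        where
        rearr : ∀ a x y w z g u → ℚ.- ((a ℚ.* x ℚ.+ y) ℚ.* w) ℚ.* z ℚ.+ (a ℚ.* g ℚ.+ u)
                ≡ a ℚ.* (ℚ.- (x ℚ.* w) ℚ.* z ℚ.+ g) ℚ.+ (ℚ.- (y ℚ.* w) ℚ.* z ℚ.+ u)
        rearr = solve 7 (λ a x y w z g u → (:- ((a :* x :+ y) :* w)) :* z :+ (a :* g :+ u)
                := a :* ((:- (x :* w)) :* z :+ g) :+ ((:- (y :* w)) :* z :+ u)) refl

      span-π : ∀ {v} → Span G v → Span (map π G) (π v)
      span-π {v} (nil v≗0) = nil (λ i → trans (π-zero (linear-0 lin v≗0) i) (v≗0 i))
      span-π (step a g∈G s eq) = step a (∈-map⁺ π g∈G) (span-π s) (π-lin a eq)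

      span-≗ : ∀ {H v w} → v ≗ w → Span H v → Span H w
      span-≗ v≗w (nil z)          = nil (λ i → trans (sym (v≗w i)) (z i))
      span-≗ v≗w (step a g∈ s eq) = step a g∈ s (λ i → trans (sym (v≗w i)) (eq i))

    finGen-∩ker : FinGen P → FinGen (λ v → P v × f v ≡ 0ℚ)
    finGen-∩ker (G , PG , gen) with Any.any? (λ g → ¬? (f g ℚ.≟ 0ℚ)) G
    ... | yes some with List.find some
    ...   | g₀ , g₀∈G , fg₀≢0 = map π G , All.map⁺ (All.map (λ Pg → Pπ Pg , fπ _) PG) ,
            λ (Pv , fv≡0) → span-≗ (π-zero fv≡0) (span-π (gen Pv))
      where open Pivot G PG g₀∈G fg₀≢0
    finGen-∩ker (G , PG , gen) | no none =
      G , All.zip (PG , All.map (λ {g} ¬fg≢0 → decidable-stable (f g ℚ.≟ 0ℚ) ¬fg≢0) (All.¬Any⇒All¬ G none)) ,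
      λ (Pv , _) → gen Pv

  linear-map : ∀ {A : Set} (F : A → V → ℚ) → (∀ x → Linear (F x)) → ∀ xs → All Linear (map F xs)
  linear-map F lin []       = []
  linear-map F lin (x ∷ xs) = lin x ∷ linear-map F lin xs

  Ker : List (V → ℚ) → V → Set
  Ker fs v = All (λ f → f v ≡ 0ℚ) fs

  ker∷ : ∀ {f fs v} → Ker fs v × f v ≡ 0ℚ → Ker (f ∷ fs) v
  ker∷ (ks , k) = k ∷ ks

  Ker-subspace : ∀ {fs} → All Linear fs → Subspace (Ker fs)
  Ker-subspace []         = record { zero∈ = λ _ → [] ; comb∈ = λ _ _ _ _ → [] }
  Ker-subspace (lin ∷ ls) = record
    { zero∈ = λ z → ker∷ (Subspace.zero∈ S z)
    ; comb∈ = λ { a (g ∷ gs) (u ∷ us) eq → ker∷ (Subspace.comb∈ S a (gs , g) (us , u) eq) }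
    }
    where S = ∩-subspace (Ker-subspace ls) (ker-subspace lin)

  module _ (_≟_ : DecidableEquality I) (L : List I) (complete : ∀ i → i List.∈ L) where

    unit : I → V
    unit i j with i ≟ j
    ... | yes _ = 1ℚ
    ... | no  _ = 0ℚ

    span-mono : ∀ {G g v} → Span G v → Span (g ∷ G) v
    span-mono (nil z)          = nil z
    span-mono (step a g∈ s eq) = step a (there g∈) (span-mono s) eq

    supported : ∀ J {v} → (∀ i → ¬ (i List.∈ J) → v i ≡ 0ℚ) → Span (map unit J) v
    supported []      z = nil (λ i → z i (λ ()))
    supported (i ∷ J) {v} z = step (v i) {u = u} (here refl) (span-mono (supported J zu)) split
      where
      u : V
      u j = v j ℚ.+ ℚ.- (v i ℚ.* unit i j)
      split : ∀ j → v j ≡ v i ℚ.* unit i j ℚ.+ u j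
      split j = solve 2 (λ x y → x := y :+ (x :+ (:- y))) refl (v j) (v i ℚ.* unit i j)
      zu : ∀ j → ¬ (j List.∈ J) → u j ≡ 0ℚ
      zu j j∉J with i ≟ j
      ... | yes refl = solve 1 (λ x → x :+ (:- (x :* con 1ℚ)) := con 0ℚ) refl (v j)
      ... | no  i≢j  = trans (cong (λ x → x ℚ.+ ℚ.- (v i ℚ.* 0ℚ)) (z j λ { (here j≡i) → i≢j (sym j≡i) ; (there j∈J) → j∉J j∈J }))
                             (solve 1 (λ x → con 0ℚ :+ (:- (x :* con 0ℚ)) := con 0ℚ) refl (v i))

    finGen-Ker : ∀ {fs} → All Linear fs → FinGen (Ker fs)
    finGen-Ker [] = map unit L , All.tabulate (λ _ → []) , λ _ → supported L (λ i i∉L → contradiction (complete i) i∉L)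
    finGen-Ker (lin ∷ ls) with finGen-∩ker (Ker-subspace ls) lin (finGen-Ker ls)
    ... | G , PG , gen = G , All.map ker∷ PG , λ { (k ∷ ks) → gen (ks , k) }

    nonzero-Ker? : ∀ {fs} → All Linear fs → ∀ i → Dec (∃ λ w → Ker fs w × w i ≢ 0ℚ)
    nonzero-Ker? {fs} ls i with finGen-Ker ls
    ... | G , PG , gen with Any.any? (λ w → ¬? (w i ℚ.≟ 0ℚ)) G
    ...   | yes some = let w , w∈G , wi≢0 = List.find some in yes (w , All.lookup PG w∈G , wi≢0)
    ...   | no none  = no λ (w , kw , wi≢0) → wi≢0 (vanish (gen kw))
      where
      vanish : ∀ {w} → Span G w → w i ≡ 0ℚ
      vanish = span⊆ (ker-subspace {f = λ w → w i} (λ a eq → eq i))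
                 (All.map (λ {w} → decidable-stable (w i ℚ.≟ 0ℚ)) (All.¬Any⇒All¬ G none))

    Ker⊆? : ∀ {fs} → All Linear fs → ∀ {Q} → Subspace Q → Decidable Q → Dec (∀ v → Ker fs v → Q v)
    Ker⊆? ls S Q? with finGen-Ker ls
    ... | G , PG , gen = Dec.map′ (λ QG v kv → span⊆ S QG (gen kv)) (λ K⊆Q → All.map (λ {v} → K⊆Q v) PG) (All.all? Q? G)

module _ {n : ℕ} where
  open LinearAlgebra

  offFace : Complex n → ℕ → Subset n → (Subset n → ℚ) → ℚ
  offFace K d σ c with face? K σ ×-dec (∣ σ ∣ ℕ.≟ d)
  ... | yes _ = 0ℚ
  ... | no  _ = c σ

  offFace⇒chain : ∀ K d {c} → (∀ σ → offFace K d σ c ≡ 0ℚ) → IsChain K d c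
  offFace⇒chain K d z σ ¬face with face? K σ ×-dec (∣ σ ∣ ℕ.≟ d) | z σ
  ... | yes face | _  = contradiction face ¬face
  ... | no  _    | eq = eq

  chain⇒offFace : ∀ K d {c} → IsChain K d c → ∀ σ → offFace K d σ c ≡ 0ℚ
  chain⇒offFace K d ch σ with face? K σ ×-dec (∣ σ ∣ ℕ.≟ d)
  ... | yes _     = refl
  ... | no  ¬face = ch σ ¬face

  offFace-linear : ∀ K d σ → Linear (offFace K d σ)
  offFace-linear K d σ a eq with face? K σ ×-dec (∣ σ ∣ ℕ.≟ d)
  ... | yes _ = sym (a0+0≡0 a)
  ... | no  _ = eq σ

  ∂-term-linear : ∀ (τ : Subset n) v → Linear (λ c → ∂-term c τ v)
  ∂-term-linear τ v a {g} {u} eq with v ∈? τ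
  ... | yes _ = sym (a0+0≡0 a)
  ... | no  _ = trans (cong (sgn v τ ℚ.*_) (eq (τ ∪ ⁅ v ⁆)))
    (rearr (sgn v τ) a (g (τ ∪ ⁅ v ⁆)) (u (τ ∪ ⁅ v ⁆)))
    where
    rearr : ∀ s a x y → s ℚ.* (a ℚ.* x ℚ.+ y) ≡ a ℚ.* (s ℚ.* x) ℚ.+ s ℚ.* y
    rearr = solve 4 (λ s a x y → s :* (a :* x :+ y) := a :* (s :* x) :+ s :* y) refl

  ∂-linear : ∀ (τ : Subset n) → Linear (λ c → ∂ c τ)
  ∂-linear τ {c} a {g} {u} eq = begin
    sum (∂-term c τ)                                               ≡⟨ sum-cong-≗ (λ v → ∂-term-linear τ v a eq) ⟩
    sum (λ v → a ℚ.* ∂-term g τ v ℚ.+ ∂-term u τ v)                ≡⟨ ∑-distrib-+ (λ v → a ℚ.* ∂-term g τ v) (∂-term u τ) ⟩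
    sum (λ v → a ℚ.* ∂-term g τ v) ℚ.+ sum (∂-term u τ)            ≡⟨ cong (ℚ._+ sum (∂-term u τ)) (sym (*-distribˡ-sum a (∂-term g τ))) ⟩
    a ℚ.* sum (∂-term g τ) ℚ.+ sum (∂-term u τ)                    ∎
    where open ≡-Reasoning

  all-subsets : ∀ {P : Subset n → Set} → All P (subsets n) → ∀ σ → P σ
  all-subsets ps σ = All.lookup ps (∈-subsets σ)

  module _ (K : Complex n) (d : ℕ) where

    cycle-equations : List ((Subset n → ℚ) → ℚ)
    cycle-equations = map (offFace K d) (subsets n) ++ map (λ τ c → ∂ c τ) (subsets n)

    cycle-equations-linear : All Linear cycle-equations
    cycle-equations-linear = All.++⁺ (linear-map (offFace K d) (offFace-linear K d) (subsets n))
                                     (linear-map (λ τ c → ∂ c τ) ∂-linear (subsets n))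

    cycle-to : ∀ {c} → Ker cycle-equations c → IsCycle K d c
    cycle-to ks = offFace⇒chain K d (all-subsets (All.map⁻ (All.++⁻ˡ (map (offFace K d) (subsets n)) ks))) ,
                  all-subsets (All.map⁻ (All.++⁻ʳ (map (offFace K d) (subsets n)) ks))

    cycle-from : ∀ {c} → IsCycle K d c → Ker cycle-equations c
    cycle-from (ch , cy) = All.++⁺ (All.map⁺ (All.universal (chain⇒offFace K d ch) (subsets n)))
                                   (All.map⁺ (All.universal cy (subsets n)))

    -- Vectors indexed by Maybe (Subset n) are pairs (a , b) of a scalar and a
    -- chain; the boundary equations say that ∂ b = a z.
    offs : List ((Maybe (Subset n) → ℚ) → ℚ)
    offs = map (λ σ w → offFace K (suc d) σ (w ∘ just)) (subsets n)

    boundary-equations : (Subset n → ℚ) → List ((Maybe (Subset n) → ℚ) → ℚ)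
    boundary-equations z = offs ++ map (λ τ w → ∂ (w ∘ just) τ ℚ.+ ℚ.- (w nothing ℚ.* z τ)) (subsets n)

    boundary-equations-linear : ∀ z → All Linear (boundary-equations z)
    boundary-equations-linear z =
      All.++⁺ (linear-map _ off-linear (subsets n)) (linear-map _ bd-linear (subsets n))
      where
      off-linear : ∀ σ → Linear {Maybe (Subset n)} (λ w → offFace K (suc d) σ (w ∘ just))
      off-linear σ a eq = offFace-linear K (suc d) σ a (eq ∘ just)
      bd-linear : ∀ τ → Linear {Maybe (Subset n)} (λ w → ∂ (w ∘ just) τ ℚ.+ ℚ.- (w nothing ℚ.* z τ))
      bd-linear τ {w} a {g} {u} eq = trans
        (cong₂ (λ x y → x ℚ.+ ℚ.- (y ℚ.* z τ)) (∂-linear τ a (eq ∘ just)) (eq nothing))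
        (rearr a (∂ (g ∘ just) τ) (∂ (u ∘ just) τ) (g nothing) (u nothing) (z τ))
        where
        rearr : ∀ a x y g u z → (a ℚ.* x ℚ.+ y) ℚ.+ ℚ.- ((a ℚ.* g ℚ.+ u) ℚ.* z)
                ≡ a ℚ.* (x ℚ.+ ℚ.- (g ℚ.* z)) ℚ.+ (y ℚ.+ ℚ.- (u ℚ.* z))
        rearr = solve 6 (λ a x y g u z → (a :* x :+ y) :+ (:- ((a :* g :+ u) :* z))
                := a :* (x :+ (:- (g :* z))) :+ (y :+ (:- (u :* z)))) refl

    boundary-to : ∀ {z} → (∃ λ w → Ker (boundary-equations z) w × w nothing ≢ 0ℚ) → IsBoundary K d z
    boundary-to {z} (w , kw , w≢0) = b , ch , bd
      where
      instance
        nz : ℚ.NonZero (w nothing)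
        nz = ℚ.≢-nonZero w≢0
      r : ℚ
      r = ℚ.1/ w nothing
      b : Subset n → ℚ
      b σ = r ℚ.* w (just σ)
      scale : b ≗ r ⊙ (w ∘ just) ⊕ (λ _ → 0ℚ)
      scale σ = sym (ℚ.+-identityʳ _)
      ch : IsChain K (suc d) b
      ch σ ¬face = trans (cong (r ℚ.*_) (offFace⇒chain K (suc d) (all-subsets (All.map⁻ (All.++⁻ˡ offs kw))) σ ¬face)) (ℚ.*-zeroʳ r)
      rearr : ∀ r x a z → r ℚ.* x ℚ.+ 0ℚ ≡ r ℚ.* (x ℚ.+ ℚ.- (a ℚ.* z)) ℚ.+ (r ℚ.* a) ℚ.* z
      rearr = solve 4 (λ r x a z → r :* x :+ con 0ℚ := r :* (x :+ (:- (a :* z))) :+ (r :* a) :* z) refl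
      bd : ∀ τ → ∂ b τ ≡ z τ
      bd τ = begin
        ∂ b τ
          ≡⟨ ∂-linear τ r scale ⟩
        r ℚ.* ∂ (w ∘ just) τ ℚ.+ ∂ (λ _ → 0ℚ) τ
          ≡⟨ cong (r ℚ.* ∂ (w ∘ just) τ ℚ.+_) (linear-0 (∂-linear τ) (λ _ → refl)) ⟩
        r ℚ.* ∂ (w ∘ just) τ ℚ.+ 0ℚ
          ≡⟨ rearr r (∂ (w ∘ just) τ) (w nothing) (z τ) ⟩
        r ℚ.* (∂ (w ∘ just) τ ℚ.+ ℚ.- (w nothing ℚ.* z τ)) ℚ.+ (r ℚ.* w nothing) ℚ.* z τ
          ≡⟨ cong₂ (λ x y → r ℚ.* x ℚ.+ y ℚ.* z τ) (all-subsets (All.map⁻ (All.++⁻ʳ offs kw)) τ) (ℚ.*-inverseˡ (w nothing)) ⟩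
        r ℚ.* 0ℚ ℚ.+ 1ℚ ℚ.* z τ
          ≡⟨ cong₂ ℚ._+_ (ℚ.*-zeroʳ r) (ℚ.*-identityˡ (z τ)) ⟩
        0ℚ ℚ.+ z τ
          ≡⟨ ℚ.+-identityˡ (z τ) ⟩
        z τ ∎
        where open ≡-Reasoning

    boundary-from : ∀ {z} → IsBoundary K d z → ∃ λ w → Ker (boundary-equations z) w × w nothing ≢ 0ℚ
    boundary-from {z} (b , ch , bd) = w , All.++⁺
        (All.map⁺ (All.universal (chain⇒offFace K (suc d) ch) (subsets n)))
        (All.map⁺ (All.universal eqn (subsets n))) , λ ()
      where
      w : Maybe (Subset n) → ℚ
      w nothing  = 1ℚ
      w (just σ) = b σ
      eqn : ∀ τ → ∂ b τ ℚ.+ ℚ.- (1ℚ ℚ.* z τ) ≡ 0ℚ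
      eqn τ = trans (cong₂ (λ x y → x ℚ.+ ℚ.- y) (bd τ) (ℚ.*-identityˡ (z τ))) (ℚ.+-inverseʳ (z τ))

    isBoundary? : Decidable (IsBoundary K d)
    isBoundary? z = Dec.map′ boundary-to boundary-from
      (nonzero-Ker? (Maybe.≡-dec _≟ˢ_) (nothing ∷ map just (subsets n))
        (λ { nothing → here refl ; (just σ) → there (∈-map⁺ just (∈-subsets σ)) })
        (boundary-equations-linear z) nothing)

    boundary-subspace : Subspace (IsBoundary K d)
    boundary-subspace = record
      { zero∈ = λ z → (λ _ → 0ℚ) , (λ _ _ → refl) , λ τ → trans (linear-0 (∂-linear τ) (λ _ → refl)) (sym (z τ))
      ; comb∈ = λ { a (b , ch , bd) (b′ , ch′ , bd′) eq →
          (λ σ → a ℚ.* b σ ℚ.+ b′ σ) ,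
          (λ σ ¬face → trans (cong₂ (λ x y → a ℚ.* x ℚ.+ y) (ch σ ¬face) (ch′ σ ¬face))
                             (a0+0≡0 a)) ,
          λ τ → trans (∂-linear τ a (λ _ → refl)) (trans (cong₂ (λ x y → a ℚ.* x ℚ.+ y) (bd τ) (bd′ τ)) (sym (eq τ))) }
      }

    abstract
      H̃≡0? : Dec (H̃≡0 K d)
      H̃≡0? = Dec.map′ (λ H c cy → H c (cycle-from cy)) (λ H c kc → H c (cycle-to kc))
        (Ker⊆? _≟ˢ_ (subsets n) ∈-subsets cycle-equations-linear boundary-subspace isBoundary?)

------------------------------------------------------------------------
-- The connectivity parameter η_H

ℕ∞ : Set
ℕ∞ = ℕ ⁺

open AddSup _≤_ public using () renaming (_≤⁺_ to _≤∞_; [_] to [_]≤; _≤⊤⁺ to _≤⊤∞)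

infixl 6 _+∞_

_+∞_ : ℕ∞ → ℕ → ℕ∞
[ a ] +∞ b = [ a + b ]
⊤⁺    +∞ b = ⊤⁺

-- With t = j + 2, the largest t such that H̃_i = 0 for all -1 ≤ i ≤ j is the
-- least d with H̃_(d-1) ≠ 0. Only d ≤ n can occur, as K has no face with more
-- than n vertices.
ηH : ∀ {n} → Complex n → ℕ∞
ηH {n} K with all? {n = suc n} (λ d → H̃≡0? K (toℕ d))
... | yes _   = ⊤⁺
... | no ¬all = [ toℕ (proj₁ (¬∀⟶∃¬-smallest (suc n) (λ d → H̃≡0 K (toℕ d)) (λ d → H̃≡0? K (toℕ d)) ¬all)) ]

H̃≡0-beyond : ∀ {n} (K : Complex n) {d} → n < d → H̃≡0 K d
H̃≡0-beyond {n} K {d} n<d c (ch , _) = LinearAlgebra.Subspace.zero∈ (boundary-subspace K d)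
  (λ σ → ch σ (λ (_ , ∣σ∣≡d) → ℕ.<⇒≱ n<d (subst (_≤ n) ∣σ∣≡d (∣p∣≤n σ))))

ηH-spec : ∀ {n} (K : Complex n) t → ([ t ] ≤∞ ηH K) ⇔ (∀ d → d < t → H̃≡0 K d)
ηH-spec {n} K t with all? {n = suc n} (λ d → H̃≡0? K (toℕ d))
... | yes all = mk⇔ (λ _ d _ → everywhere d) (λ _ → [ t ] ≤⊤∞)
  where
  everywhere : ∀ d → H̃≡0 K d
  everywhere d with d ≤? n
  ... | yes d≤n = subst (H̃≡0 K) (Fin.toℕ-fromℕ< (s≤s d≤n)) (all (fromℕ< (s≤s d≤n)))
  ... | no  d≰n = H̃≡0-beyond K (ℕ.≰⇒> d≰n)
... | no ¬all with ¬∀⟶∃¬-smallest (suc n) (λ d → H̃≡0 K (toℕ d)) (λ d → H̃≡0? K (toℕ d)) ¬all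
...   | i , ¬Hi , below = mk⇔ to from
  where
  to : [ t ] ≤∞ [ toℕ i ] → ∀ d → d < t → H̃≡0 K d
  to [ t≤i ]≤ d d<t = subst (H̃≡0 K) (trans (Fin.toℕ-inject (fromℕ< d<i)) (Fin.toℕ-fromℕ< d<i)) (below (fromℕ< d<i))
    where d<i = ℕ.<-≤-trans d<t t≤i
  from : (∀ d → d < t → H̃≡0 K d) → [ t ] ≤∞ [ toℕ i ]
  from H with t ≤? toℕ i
  ... | yes t≤i = [ t≤i ]≤
  ... | no  t≰i = contradiction (H (toℕ i) (ℕ.≰⇒> t≰i)) ¬Hi

{-# OPTIONS --safe #-}

-- Let N be the truncation of M at k, let V be the ground set, and let K be the
-- join of C with the dual matroid of N: its simplices are the pairs (σ , τ) with
-- σ ∈ C and V ∖ τ spanning in N. For ∅ ≠ I ⊆ V, deletion and contraction show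
-- that K[I] has η ≥ η(C[I]) + ∣I∣ - k + r(V ∖ I), and that K[I] is acyclic if
-- V ∖ I is not a flat, since then the dual matroid has a coloop in I. Hence
-- η(K[I]) ≥ ∣I∣ + m. Gluing in the full simplices on V - v for all points v, that
-- is, all pairs with σ ∪ τ ≠ V, preserves this bound by Mayer–Vietoris; let K⁺ be
-- the result, so η(K⁺) ≥ ∣V∣ + m.
--
-- Next let T consist of the triples (σ , τ , x) with x a chain in Int such that
-- either σ ∪ τ ≠ V, or (σ , τ) ∈ K and σ is contained in every member of x. Over
-- x = ∅ it is K⁺. The link of a chain x ≠ ∅ is K⁺ formed with the full simplex on
-- min x in place of C, which is acyclic; hence η(T) ≥ ∣V∣ + m. Over a pair with
-- σ ∪ τ = V the chains x form a cone with apex σ, so deleting these pairs does not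
-- change the homology. What remains is the join of Int with a sphere of dimension
-- ∣V∣ - 2, that is, the (∣V∣ - 1)-fold suspension of Int, and η(Int) ≥ m + 1.
module Submission where

open import Defs
import Data.Empty as Empty
open import Data.Fin using (Fin; zero; suc; _↑ˡ_; _↑ʳ_; splitAt)
import Data.Fin.Properties as Fin
open import Data.Fin.Subset using (Subset; inside; outside; ⊥; ⊤; ⁅_⁆; _∪_; _∩_; ∁; ∣_∣; _∈_; _∉_; _⊆_; _─_; _-_; Nonempty)
open import Data.Fin.Subset.Properties
open import Data.List as List using (List; []; _∷_; lookup; length; allFin; map; filter)
open import Data.List.Extrema.Nat using (xs≤max; argmax-sel)
open import Data.List.Membership.Propositional using (find; lose) renaming (_∈_ to _∈ᴸ_)
open import Data.List.Membership.Propositional.Properties using (∈-allFin; ∈-filter⁺; ∈-filter⁻; ∈-lookup; ∈-map⁺; ∈-map⁻)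
open import Data.List.Properties using (length-tabulate)
open import Data.List.Relation.Unary.All as All using (All; []; _∷_)
open import Data.List.Relation.Unary.Any as Any using (Any; here; there)
open import Data.List.Relation.Unary.Any.Properties using (lookup-index)
open import Data.List.Relation.Unary.Unique.Propositional using (Unique; []; _∷_)
open import Data.List.Relation.Unary.Unique.Propositional.Properties using (allFin⁺)
open import Data.Nat using (ℕ; zero; suc; _+_; _∸_; _≤_; _<_; z≤n; s≤s; s≤s⁻¹; _≤?_)
import Data.Nat.Properties as ℕ
open import Data.Product using (∃; _×_; _,_; proj₁; proj₂)
open import Data.Rational as ℚ using (ℚ; 0ℚ; 1ℚ)
import Data.Rational.Properties as ℚ
open import Data.Rational.Solver using (module +-*-Solver)
open import Data.Sum using (_⊎_; inj₁; inj₂; [_,_]′)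
open import Data.Vec as Vec using ([]; _∷_; here; there; tabulate)
import Data.Vec.Properties as Vec
open import Function using (_∘_; id)
open import Function.Bundles using (module Equivalence)
open import Level using (0ℓ)
open import Relation.Binary.PropositionalEquality using (_≡_; _≢_; _≗_; refl; sym; trans; cong; cong₂; subst; module ≡-Reasoning)
open import Relation.Nullary using (¬_; Dec; yes; no; contradiction)
open import Relation.Nullary.Construct.Add.Supremum using ([_]; ⊤⁺)
open import Relation.Nullary.Decidable using (_×-dec_; _→-dec_; _⊎-dec_; ¬?; decidable-stable)
open import Relation.Unary using (Pred; Decidable) renaming (_⊆_ to _⇒_)
open import Algebra.Properties.CommutativeMonoid.Sum ℚ.+-0-commutativeMonoid using (sum-cong-≗; sum-replicate-zero)

open +-*-Solver using (solve; _:=_; _:+_; _:*_; :-_; _:-_; con)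

-- Reduced homology: Mayer–Vietoris, cones and order-preserving injections

x+[y-x]≡y : ∀ x y → x ℚ.+ (y ℚ.- x) ≡ y
x+[y-x]≡y = solve 2 (λ x y → x :+ (y :- x) := y) refl

[x+y]-x≡y : ∀ x y → x ℚ.+ y ℚ.- x ≡ y
[x+y]-x≡y = solve 2 (λ x y → (x :+ y) :- x := y) refl

[x+y]-y≡x : ∀ x y → x ℚ.+ y ℚ.- y ≡ x
[x+y]-y≡x = solve 2 (λ x y → (x :+ y) :- y := x) refl

Chain : ℕ → Set
Chain n = Subset n → ℚ

module _ {n : ℕ} where

  ∂-cong : ∀ {c c′ : Chain n} → c ≗ c′ → ∂ c ≗ ∂ c′
  ∂-cong {c} {c′} eq τ = trans (∂-linear τ 1ℚ {g = c′} {u = λ _ → 0ℚ} (λ σ → trans (eq σ) (1x+0 (c′ σ))))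
    (trans (cong (1ℚ ℚ.* ∂ c′ τ ℚ.+_) (LinearAlgebra.linear-0 (∂-linear τ) (λ _ → refl))) (sym (1x+0 (∂ c′ τ))))
    where
    1x+0 : ∀ x → x ≡ 1ℚ ℚ.* x ℚ.+ 0ℚ
    1x+0 = solve 1 (λ x → x := con 1ℚ :* x :+ con 0ℚ) refl

  ∂-zero : ∀ {c : Chain n} → (∀ σ → c σ ≡ 0ℚ) → ∀ τ → ∂ c τ ≡ 0ℚ
  ∂-zero c≡0 τ = LinearAlgebra.linear-0 (∂-linear τ) c≡0

  ∂-+ : ∀ (c c′ : Chain n) τ → ∂ (λ σ → c σ ℚ.+ c′ σ) τ ≡ ∂ c τ ℚ.+ ∂ c′ τ
  ∂-+ c c′ τ = trans (∂-linear τ 1ℚ {g = c} {u = c′} (λ σ → cong (ℚ._+ c′ σ) (sym (ℚ.*-identityˡ (c σ)))))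
                     (cong (ℚ._+ ∂ c′ τ) (ℚ.*-identityˡ (∂ c τ)))

  ∂-- : ∀ (c c′ : Chain n) τ → ∂ (λ σ → c σ ℚ.- c′ σ) τ ≡ ∂ c τ ℚ.- ∂ c′ τ
  ∂-- c c′ τ = trans (∂-linear τ (ℚ.- 1ℚ) {g = c′} {u = c} (λ σ → flip (c σ) (c′ σ))) (sym (flip (∂ c τ) (∂ c′ τ)))
    where
    flip : ∀ x y → x ℚ.- y ≡ ℚ.- 1ℚ ℚ.* y ℚ.+ x
    flip = solve 2 (λ x y → x :- y := (:- con 1ℚ) :* y :+ x) refl

  ∂-neg : ∀ (c : Chain n) τ → ∂ (λ σ → ℚ.- c σ) τ ≡ ℚ.- ∂ c τ
  ∂-neg c τ = trans (∂-linear τ (ℚ.- 1ℚ) {g = c} {u = λ _ → 0ℚ} (λ σ → neg (c σ)))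
    (trans (cong (ℚ.- 1ℚ ℚ.* ∂ c τ ℚ.+_) (∂-zero (λ _ → refl) τ)) (sym (neg (∂ c τ))))
    where
    neg : ∀ x → ℚ.- x ≡ ℚ.- 1ℚ ℚ.* x ℚ.+ 0ℚ
    neg = solve 1 (λ x → :- x := (:- con 1ℚ) :* x :+ con 0ℚ) refl

-- With `∂-inside` this is the block form of `∂` when faces are split by whether they contain the
-- first point. The sign in `∂-inside` arises because every other vertex comes after that point. The
-- identities for `∂ (∂ c)`, `cone` and `push` follow from the two by induction.
∂-outside : ∀ {n} (c : Chain (suc n)) τ → ∂ c (outside ∷ τ) ≡ c (inside ∷ τ) ℚ.+ ∂ (λ σ → c (outside ∷ σ)) τ
∂-outside c τ = cong₂ ℚ._+_
  (trans (ℚ.*-identityˡ _) (cong (c ∘ (inside ∷_)) (∪-identityʳ τ)))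
  (sum-cong-≗ term)
  where
  term : ∀ v → ∂-term c (outside ∷ τ) (suc v) ≡ ∂-term (λ σ → c (outside ∷ σ)) τ v
  term v with v ∈? τ
  ... | yes _ = refl
  ... | no  _ = refl

∂-inside : ∀ {n} (c : Chain (suc n)) τ → ∂ c (inside ∷ τ) ≡ ℚ.- ∂ (λ σ → c (inside ∷ σ)) τ
∂-inside c τ = trans (ℚ.+-identityˡ _) (trans (sum-cong-≗ term) (∂-neg (λ σ → c (inside ∷ σ)) τ))
  where
  term : ∀ v → ∂-term c (inside ∷ τ) (suc v) ≡ ∂-term (λ σ → ℚ.- c (inside ∷ σ)) τ v
  term v with v ∈? τ
  ... | yes _ = refl
  ... | no  _ = trans (sym (ℚ.neg-distribˡ-* (sgn v τ) _)) (ℚ.neg-distribʳ-* (sgn v τ) _)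

∂∂≡0 : ∀ {n} (c : Chain n) τ → ∂ (∂ c) τ ≡ 0ℚ
∂∂≡0 c [] = refl
∂∂≡0 c (outside ∷ τ) = begin
  ∂ (∂ c) (outside ∷ τ)
    ≡⟨ ∂-outside (∂ c) τ ⟩
  ∂ c (inside ∷ τ) ℚ.+ ∂ (λ σ → ∂ c (outside ∷ σ)) τ
    ≡⟨ cong₂ ℚ._+_ (∂-inside c τ) (trans (∂-cong (∂-outside c) τ) (∂-+ (λ σ → c (inside ∷ σ)) (∂ (λ σ → c (outside ∷ σ))) τ)) ⟩
  ℚ.- x ℚ.+ (x ℚ.+ ∂ (∂ (λ σ → c (outside ∷ σ))) τ)
    ≡⟨ cong (λ y → ℚ.- x ℚ.+ (x ℚ.+ y)) (∂∂≡0 (λ σ → c (outside ∷ σ)) τ) ⟩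
  ℚ.- x ℚ.+ (x ℚ.+ 0ℚ)
    ≡⟨ solve 1 (λ x → (:- x) :+ (x :+ con 0ℚ) := con 0ℚ) refl x ⟩
  0ℚ ∎
  where
  open ≡-Reasoning
  x = ∂ (λ σ → c (inside ∷ σ)) τ
∂∂≡0 c (inside ∷ τ) = begin
  ∂ (∂ c) (inside ∷ τ)                                ≡⟨ ∂-inside (∂ c) τ ⟩
  ℚ.- ∂ (λ σ → ∂ c (inside ∷ σ)) τ                    ≡⟨ cong ℚ.-_ (trans (∂-cong (∂-inside c) τ) (∂-neg (∂ (λ σ → c (inside ∷ σ))) τ)) ⟩
  ℚ.- (ℚ.- ∂ (∂ (λ σ → c (inside ∷ σ))) τ)            ≡⟨ cong (ℚ.-_ ∘ ℚ.-_) (∂∂≡0 (λ σ → c (inside ∷ σ)) τ) ⟩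
  0ℚ                                                  ∎
  where open ≡-Reasoning

∣p∪⁅x⁆∣≡1+∣p∣ : ∀ {n} {x : Fin n} (p : Subset n) → x ∉ p → ∣ p ∪ ⁅ x ⁆ ∣ ≡ suc ∣ p ∣
∣p∪⁅x⁆∣≡1+∣p∣ {x = zero}  (inside  ∷ p) x∉p = contradiction here x∉p
∣p∪⁅x⁆∣≡1+∣p∣ {x = zero}  (outside ∷ p) x∉p = cong (suc ∘ ∣_∣) (∪-identityʳ p)
∣p∪⁅x⁆∣≡1+∣p∣ {x = suc x} (inside  ∷ p) x∉p = cong suc (∣p∪⁅x⁆∣≡1+∣p∣ p (x∉p ∘ there))
∣p∪⁅x⁆∣≡1+∣p∣ {x = suc x} (outside ∷ p) x∉p = ∣p∪⁅x⁆∣≡1+∣p∣ p (x∉p ∘ there)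

module _ {n : ℕ} where

  ∂-vanishes : ∀ {c : Chain n} {τ} → (∀ v → v ∉ τ → c (τ ∪ ⁅ v ⁆) ≡ 0ℚ) → ∂ c τ ≡ 0ℚ
  ∂-vanishes {c} {τ} z = trans (sum-cong-≗ term) (sum-replicate-zero n)
    where
    term : ∀ v → ∂-term c τ v ≡ 0ℚ
    term v with v ∈? τ
    ... | yes _   = refl
    ... | no  v∉τ = trans (cong (sgn v τ ℚ.*_) (z v v∉τ)) (ℚ.*-zeroʳ (sgn v τ))

  ∂-chain : ∀ (K : Complex n) {d c} → IsChain K (suc d) c → IsChain K d (∂ c)
  ∂-chain K ch τ ¬face = ∂-vanishes λ v v∉τ → ch (τ ∪ ⁅ v ⁆) λ (f , eq) →
    ¬face (down-closed K (p⊆p∪q ⁅ v ⁆) f , ℕ.suc-injective (trans (sym (∣p∪⁅x⁆∣≡1+∣p∣ τ v∉τ)) eq))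

  chain-+ : ∀ (K : Complex n) {d c c′} → IsChain K d c → IsChain K d c′ → IsChain K d (λ σ → c σ ℚ.+ c′ σ)
  chain-+ K ch ch′ σ ¬f = cong₂ ℚ._+_ (ch σ ¬f) (ch′ σ ¬f)

  chain-- : ∀ (K : Complex n) {d c c′} → IsChain K d c → IsChain K d c′ → IsChain K d (λ σ → c σ ℚ.- c′ σ)
  chain-- K ch ch′ σ ¬f = cong₂ ℚ._-_ (ch σ ¬f) (ch′ σ ¬f)

  chain-resp : ∀ (K : Complex n) {d c c′} → c ≗ c′ → IsChain K d c → IsChain K d c′
  chain-resp K eq ch σ ¬f = trans (sym (eq σ)) (ch σ ¬f)

  chain-mono : ∀ {K K′ : Complex n} → Face K ⇒ Face K′ → ∀ {d c} → IsChain K d c → IsChain K′ d c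
  chain-mono K⊆K′ ch σ ¬f = ch σ (λ (f , eq) → ¬f (K⊆K′ f , eq))

  restrict : Complex n → Chain n → Chain n
  restrict K c σ with face? K σ
  ... | yes _ = c σ
  ... | no  _ = 0ℚ

-- Acyclic K t states that the reduced homology of K vanishes in all
-- dimensions below t - 1, i.e. that η_H K ≥ t.
Acyclic : ∀ {n} → Complex n → ℕ → Set
Acyclic K t = ∀ d → d < t → H̃≡0 K d

acyclic-≤ : ∀ {n} {K : Complex n} {s t} → s ≤ t → Acyclic K t → Acyclic K s
acyclic-≤ s≤t H d d<s = H d (ℕ.<-≤-trans d<s s≤t)

acyclic-resp : ∀ {n} {K K′ : Complex n} → Face K ⇒ Face K′ → Face K′ ⇒ Face K → ∀ {t} → Acyclic K t → Acyclic K′ t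
acyclic-resp {K = K} {K′} to from H d d<t c (ch , cy) with H d d<t c (chain-mono {K = K′} {K} from ch , cy)
... | b , chb , ∂b = b , chain-mono {K = K} {K′} to chb , ∂b

-- `K` is the union of `A` and `B`, and `I` is their intersection. `I` is given separately so that
-- it can be a member of the family over which an induction runs.
record Cover {n} (K A B I : Complex n) : Set where
  field
    A⊆K   : Face A ⇒ Face K
    B⊆K   : Face B ⇒ Face K
    K⊆A∪B : ∀ {σ} → Face K σ → Face A σ ⊎ Face B σ
    I⊆A   : Face I ⇒ Face A
    I⊆B   : Face I ⇒ Face B
    A∩B⊆I : ∀ {σ} → Face A σ → Face B σ → Face I σ

module MayerVietoris {n} {K A B I : Complex n} (cover : Cover K A B I) where
  open Cover cover

  -- A chain of `K` is the sum of `inA c` and `inB c`; faces common to `A` and `B` go to `inA`.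
  inA : Chain n → Chain n
  inA = restrict A

  inB : Chain n → Chain n
  inB c σ = c σ ℚ.- inA c σ

  inA-chain : ∀ {d c} → IsChain K d c → IsChain A d (inA c)
  inA-chain ch σ ¬f with face? A σ
  ... | yes a = ch σ (λ (_ , eq) → ¬f (a , eq))
  ... | no  _ = refl

  inB-chain : ∀ {d c} → IsChain K d c → IsChain B d (inB c)
  inB-chain {c = c} ch σ ¬f with face? A σ
  ... | yes a  = ℚ.+-inverseʳ (c σ)
  ... | no  ¬a = trans (ℚ.+-identityʳ (c σ)) (ch σ notK)
    where
    notK : ¬ (Face K σ × ∣ σ ∣ ≡ _)
    notK (k , eq) with K⊆A∪B k
    ... | inj₁ a = ¬a a
    ... | inj₂ b = ¬f (b , eq)

  ∂-inA+inB : ∀ c τ → ∂ (inA c) τ ℚ.+ ∂ (inB c) τ ≡ ∂ c τ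
  ∂-inA+inB c τ = trans (cong (∂ (inA c) τ ℚ.+_) (∂-- c (inA c) τ))
    (x+[y-x]≡y (∂ (inA c) τ) (∂ c τ))

  chain-I : ∀ {d c} → IsChain A d c → IsChain B d c → IsChain I d c
  chain-I {d} chA chB σ ¬f with face? A σ | face? B σ | ∣ σ ∣ ℕ.≟ d
  ... | no ¬a | _     | _      = chA σ (¬a ∘ proj₁)
  ... | _     | no ¬b | _      = chB σ (¬b ∘ proj₁)
  ... | _     | _     | no ¬eq = chA σ (¬eq ∘ proj₂)
  ... | yes a | yes b | yes eq = contradiction (A∩B⊆I a b , eq) ¬f

  -- The boundary of the part of `z` in `A` is, up to sign, that of the part in `B`, so it is a
  -- cycle of `I`. A filling `w` in `I` corrects both parts to cycles, and fillings of these add up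
  -- to one of `z`.
  union-H̃≡0 : ∀ {d} → H̃≡0 A (suc d) → H̃≡0 B (suc d) → H̃≡0 I d → H̃≡0 K (suc d)
  union-H̃≡0 HA HB HI z (chz , ∂z) = fill (HI y (y-chain , ∂∂≡0 a))
    where
    a b y : Chain n
    a = inA z
    b = inB z
    y = ∂ a
    y≡-∂b : ∀ τ → 0ℚ ℚ.- ∂ b τ ≡ y τ
    y≡-∂b τ = trans (cong (ℚ._- ∂ b τ) (trans (sym (∂z τ)) (sym (∂-inA+inB z τ))))
                    ([x+y]-y≡x (y τ) (∂ b τ))
    y-chain : IsChain I _ y
    y-chain = chain-I (∂-chain A (inA-chain chz))
      (chain-resp B y≡-∂b (chain-- B (λ _ _ → refl) (∂-chain B (inB-chain chz))))
    recombine : ∀ z a w → (a ℚ.- w) ℚ.+ ((z ℚ.- a) ℚ.+ w) ≡ z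
    recombine = solve 3 (λ z a w → (a :- w) :+ ((z :- a) :+ w) := z) refl
    fill : IsBoundary I _ y → IsBoundary K _ z
    fill (w , chw , ∂w) = glue
        (HA (λ σ → a σ ℚ.- w σ) (chain-- A (inA-chain chz) (chain-mono {K = I} {A} I⊆A chw) ,
          λ τ → trans (∂-- a w τ) (trans (cong (λ x → y τ ℚ.- x) (∂w τ)) (ℚ.+-inverseʳ (y τ)))))
        (HB (λ σ → b σ ℚ.+ w σ) (chain-+ B (inB-chain chz) (chain-mono {K = I} {B} I⊆B chw) ,
          λ τ → trans (∂-+ b w τ) (trans (trans (cong (∂ b τ ℚ.+_) (∂w τ)) (ℚ.+-comm (∂ b τ) (y τ)))
                  (trans (∂-inA+inB z τ) (∂z τ)))))
      where
      glue : IsBoundary A _ (λ σ → a σ ℚ.- w σ) → IsBoundary B _ (λ σ → b σ ℚ.+ w σ) → IsBoundary K _ z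
      glue (p , chp , ∂p) (q , chq , ∂q) = (λ σ → p σ ℚ.+ q σ) ,
        chain-+ K (chain-mono {K = A} {K} A⊆K chp) (chain-mono {K = B} {K} B⊆K chq) ,
        λ τ → trans (∂-+ p q τ) (trans (cong₂ ℚ._+_ (∂p τ) (∂q τ)) (recombine (z τ) (a τ) (w τ)))

  union : ∀ {t} → Acyclic A (suc t) → Acyclic B (suc t) → Acyclic I t → Acyclic K (suc t)
  union HA HB HI (suc d) (s≤s d<t) = union-H̃≡0 (HA (suc d) (s≤s d<t)) (HB (suc d) (s≤s d<t)) (HI d d<t)
  -- A chain of degree 0 is supported on the empty face, which lies in `A`, so `z` can be filled in
  -- `A` alone.
  union HA HB HI zero    0<t z (chz , ∂z) with HA zero 0<t z (chA , ∂z)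
    where
    chA : IsChain A 0 z
    chA σ ¬f = chz σ λ (_ , eq) → ¬f (subst (Face A) (sym (empty σ eq)) (∅-face A) , eq)
      where
      empty : ∀ {m} (σ : Subset m) → ∣ σ ∣ ≡ 0 → σ ≡ ⊥
      empty []            _  = refl
      empty (outside ∷ σ) eq = cong (outside ∷_) (empty σ eq)
  ... | b , chb , ∂b = b , chain-mono {K = A} {K} A⊆K chb , ∂b

  -- Let `z` be the boundary of `a` in `A` and of `b` in `B`, and let `a - b` be the boundary of `c`
  -- in `K`. Then `a - ∂ (inA c)` equals `b + ∂ (inB c)`, so it lies in `I`, and its boundary is
  -- `z`.
  intersection : ∀ {t} → Acyclic K (suc t) → Acyclic A t → Acyclic B t → Acyclic I t
  intersection HK HA HB d d<t z (chz , ∂z) =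
    fill (HA d d<t z (chain-mono {K = I} {A} I⊆A chz , ∂z)) (HB d d<t z (chain-mono {K = I} {B} I⊆B chz , ∂z))
    where
    regroup : ∀ a b x y → x ℚ.+ y ≡ a ℚ.- b → b ℚ.+ y ≡ a ℚ.- x
    regroup a b x y eq = trans (solve 3 (λ b x y → b :+ y := (b :+ (x :+ y)) :- x) refl b x y)
      (trans (cong (λ w → b ℚ.+ w ℚ.- x) eq) (cong (ℚ._- x) (x+[y-x]≡y b a)))
    fill : IsBoundary A d z → IsBoundary B d z → IsBoundary I d z
    fill (a , cha , ∂a) (b , chb , ∂b) = cut (HK (suc d) (s≤s d<t) (λ σ → a σ ℚ.- b σ)
        (chain-- K (chain-mono {K = A} {K} A⊆K cha) (chain-mono {K = B} {K} B⊆K chb) ,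
         λ τ → trans (∂-- a b τ) (trans (cong₂ ℚ._-_ (∂a τ) (∂b τ)) (ℚ.+-inverseʳ (z τ)))))
      where
      cut : IsBoundary K (suc d) (λ σ → a σ ℚ.- b σ) → IsBoundary I d z
      cut (c , chc , ∂c) = (λ σ → a σ ℚ.- ∂ (inA c) σ) ,
        chain-I (chain-- A cha (∂-chain A (inA-chain chc)))
          (chain-resp B
            (λ σ → regroup (a σ) (b σ) (∂ (inA c) σ) (∂ (inB c) σ) (trans (∂-inA+inB c σ) (∂c σ)))
            (chain-+ B chb (∂-chain B (inB-chain chc)))) ,
        λ τ → trans (∂-- a (∂ (inA c)) τ) (trans (cong₂ ℚ._-_ (∂a τ) (∂∂≡0 (inA c) τ)) (ℚ.+-identityʳ (z τ)))

  -- If `z` is the boundary of `c` in `K`, then `z - ∂ (inA c)` equals `∂ (inB c)`, so it is a cycle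
  -- of `I`; a filling of it there, added to `inA c`, fills `z` in `A`.
  part : ∀ {t} → Acyclic K t → Acyclic I t → Acyclic A t
  part HK HI d d<t z (chz , ∂z) = cut (HK d d<t z (chain-mono {K = A} {K} A⊆K chz , ∂z))
    where
    cut : IsBoundary K d z → IsBoundary A d z
    cut (c , chc , ∂c) = fill (HI d d<t (λ σ → z σ ℚ.- ∂ (inA c) σ)
        (chain-I (chain-- A chz (∂-chain A (inA-chain chc)))
          (chain-resp B
            (λ σ → trans (sym ([x+y]-x≡y (∂ (inA c) σ) (∂ (inB c) σ)))
                     (cong (ℚ._- ∂ (inA c) σ) (trans (∂-inA+inB c σ) (∂c σ))))
            (∂-chain B (inB-chain chc))) ,
         λ τ → trans (∂-- z (∂ (inA c)) τ) (cong₂ ℚ._-_ (∂z τ) (∂∂≡0 (inA c) τ))))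
      where
      fill : IsBoundary I d (λ σ → z σ ℚ.- ∂ (inA c) σ) → IsBoundary A d z
      fill (e , che , ∂e) = (λ σ → inA c σ ℚ.+ e σ) , chain-+ A (inA-chain chc) (chain-mono {K = I} {A} I⊆A che) ,
        λ τ → trans (∂-+ (inA c) e τ) (trans (cong (∂ (inA c) τ ℚ.+_) (∂e τ)) (x+[y-x]≡y (∂ (inA c) τ) (z τ)))

-- The contracting homotopy c ↦ ± a ∗ c of a cone with apex a.
cone : ∀ {n} → Fin n → Chain n → Chain n
cone zero    c (outside ∷ τ) = 0ℚ
cone zero    c (inside  ∷ τ) = c (outside ∷ τ)
cone (suc a) c (outside ∷ τ) = cone a (λ σ → c (outside ∷ σ)) τ
cone (suc a) c (inside  ∷ τ) = ℚ.- cone a (λ σ → c (inside ∷ σ)) τ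

cone-cong : ∀ {n} (a : Fin n) {c c′ : Chain n} → c ≗ c′ → cone a c ≗ cone a c′
cone-cong zero    eq (outside ∷ τ) = refl
cone-cong zero    eq (inside  ∷ τ) = eq (outside ∷ τ)
cone-cong (suc a) eq (outside ∷ τ) = cone-cong a (eq ∘ (outside ∷_)) τ
cone-cong (suc a) eq (inside  ∷ τ) = cong ℚ.-_ (cone-cong a (eq ∘ (inside ∷_)) τ)

cone-+ : ∀ {n} (a : Fin n) (c c′ : Chain n) τ → cone a (λ σ → c σ ℚ.+ c′ σ) τ ≡ cone a c τ ℚ.+ cone a c′ τ
cone-+ zero    c c′ (outside ∷ τ) = refl
cone-+ zero    c c′ (inside  ∷ τ) = refl
cone-+ (suc a) c c′ (outside ∷ τ) = cone-+ a (c ∘ (outside ∷_)) (c′ ∘ (outside ∷_)) τ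
cone-+ (suc a) c c′ (inside  ∷ τ) = trans (cong ℚ.-_ (cone-+ a (c ∘ (inside ∷_)) (c′ ∘ (inside ∷_)) τ))
  (ℚ.neg-distrib-+ (cone a (c ∘ (inside ∷_)) τ) (cone a (c′ ∘ (inside ∷_)) τ))

cone-neg : ∀ {n} (a : Fin n) (c : Chain n) τ → cone a (λ σ → ℚ.- c σ) τ ≡ ℚ.- cone a c τ
cone-neg zero    c (outside ∷ τ) = refl
cone-neg zero    c (inside  ∷ τ) = refl
cone-neg (suc a) c (outside ∷ τ) = cone-neg a (c ∘ (outside ∷_)) τ
cone-neg (suc a) c (inside  ∷ τ) = cong ℚ.-_ (cone-neg a (c ∘ (inside ∷_)) τ)

cone-vanishes : ∀ {n} (a : Fin n) {c : Chain n} τ → (∀ σ → a ∉ σ → σ ∪ ⁅ a ⁆ ≡ τ → c σ ≡ 0ℚ) → cone a c τ ≡ 0ℚ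
cone-vanishes zero    (outside ∷ τ) z = refl
cone-vanishes zero    (inside  ∷ τ) z = z (outside ∷ τ) (λ ()) (cong (inside ∷_) (∪-identityʳ τ))
cone-vanishes (suc a) (outside ∷ τ) z = cone-vanishes a τ λ σ a∉σ eq →
  z (outside ∷ σ) (a∉σ ∘ drop-there) (cong (outside ∷_) eq)
cone-vanishes (suc a) (inside  ∷ τ) z = cong ℚ.-_ (cone-vanishes a τ λ σ a∉σ eq →
  z (inside ∷ σ) (a∉σ ∘ drop-there) (cong (inside ∷_) eq))

-- The sign built into `cone` makes the mixed terms `h` cancel, so the identity passes from the
-- smaller ground set to the larger.
∂cone+cone∂ : ∀ {n} (a : Fin n) (c : Chain n) τ → ∂ (cone a c) τ ℚ.+ cone a (∂ c) τ ≡ c τ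
∂cone+cone∂ zero c (outside ∷ τ) = trans (ℚ.+-identityʳ _) (trans (∂-outside (cone zero c) τ)
  (trans (cong (c (outside ∷ τ) ℚ.+_) (∂-zero (λ _ → refl) τ)) (ℚ.+-identityʳ _)))
∂cone+cone∂ zero c (inside ∷ τ) = trans (cong₂ ℚ._+_ (∂-inside (cone zero c) τ) (∂-outside c τ))
  (solve 2 (λ x y → (:- x) :+ (y :+ x) := y) refl (∂ (λ σ → c (outside ∷ σ)) τ) (c (inside ∷ τ)))
∂cone+cone∂ (suc a) c (outside ∷ τ) = begin
  ∂ (cone (suc a) c) (outside ∷ τ) ℚ.+ cone a (λ σ → ∂ c (outside ∷ σ)) τ
    ≡⟨ cong₂ ℚ._+_ (∂-outside (cone (suc a) c) τ)
         (trans (cone-cong a (∂-outside c) τ) (cone-+ a (λ σ → c (inside ∷ σ)) (∂ (λ σ → c (outside ∷ σ))) τ)) ⟩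
  (ℚ.- h ℚ.+ x) ℚ.+ (h ℚ.+ y)
    ≡⟨ solve 3 (λ h x y → ((:- h) :+ x) :+ (h :+ y) := x :+ y) refl h x y ⟩
  x ℚ.+ y
    ≡⟨ ∂cone+cone∂ a (λ σ → c (outside ∷ σ)) τ ⟩
  c (outside ∷ τ) ∎
  where
  open ≡-Reasoning
  h = cone a (λ σ → c (inside ∷ σ)) τ
  x = ∂ (cone a (λ σ → c (outside ∷ σ))) τ
  y = cone a (∂ (λ σ → c (outside ∷ σ))) τ
∂cone+cone∂ (suc a) c (inside ∷ τ) = begin
  ∂ (cone (suc a) c) (inside ∷ τ) ℚ.+ ℚ.- cone a (λ σ → ∂ c (inside ∷ σ)) τ
    ≡⟨ cong₂ (λ u v → u ℚ.+ ℚ.- v)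
         (trans (∂-inside (cone (suc a) c) τ) (cong ℚ.-_ (∂-neg (cone a (λ σ → c (inside ∷ σ))) τ)))
         (trans (cone-cong a (∂-inside c) τ) (cone-neg a (∂ (λ σ → c (inside ∷ σ))) τ)) ⟩
  ℚ.- (ℚ.- x) ℚ.+ ℚ.- (ℚ.- y)
    ≡⟨ solve 2 (λ x y → (:- (:- x)) :+ (:- (:- y)) := x :+ y) refl x y ⟩
  x ℚ.+ y
    ≡⟨ ∂cone+cone∂ a (λ σ → c (inside ∷ σ)) τ ⟩
  c (inside ∷ τ) ∎
  where
  open ≡-Reasoning
  x = ∂ (cone a (λ σ → c (inside ∷ σ))) τ
  y = cone a (∂ (λ σ → c (inside ∷ σ))) τ

-- By the homotopy identity a cycle `c` is the boundary of `cone a c`; the closure hypothesis keeps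
-- this chain inside `K`.
cone-acyclic : ∀ {n} (K : Complex n) a → (∀ {σ} → Face K σ → Face K (σ ∪ ⁅ a ⁆)) → ∀ t → Acyclic K t
cone-acyclic K a closed t d d<t c (ch , ∂c) = cone a c , chain ,
  λ τ → trans (sym (ℚ.+-identityʳ _)) (trans (cong (∂ (cone a c) τ ℚ.+_)
    (sym (cone-vanishes a τ (λ σ _ _ → ∂c σ)))) (∂cone+cone∂ a c τ))
  where
  chain : IsChain K (suc d) (cone a c)
  chain τ ¬f = cone-vanishes a τ λ σ a∉σ eq → ch σ λ (f , ∣σ∣≡d) →
    ¬f (subst (Face K) eq (closed f) , trans (cong ∣_∣ (sym eq)) (trans (∣p∪⁅x⁆∣≡1+∣p∣ σ a∉σ) (cong suc ∣σ∣≡d)))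

-- The order-preserving injections; these respect the orientations of the faces.
data Thinning : ℕ → ℕ → Set where
  done : Thinning 0 0
  keep : ∀ {m n} → Thinning m n → Thinning (suc m) (suc n)
  skip : ∀ {m n} → Thinning m n → Thinning m (suc n)

image : ∀ {m n} → Thinning m n → Subset m → Subset n
image done     σ       = σ
image (keep θ) (s ∷ σ) = s ∷ image θ σ
image (skip θ) σ       = outside ∷ image θ σ

∣image∣ : ∀ {m n} (θ : Thinning m n) σ → ∣ image θ σ ∣ ≡ ∣ σ ∣
∣image∣ done     σ             = refl
∣image∣ (keep θ) (inside  ∷ σ) = cong suc (∣image∣ θ σ)
∣image∣ (keep θ) (outside ∷ σ) = ∣image∣ θ σ
∣image∣ (skip θ) σ             = ∣image∣ θ σ

push : ∀ {m n} → Thinning m n → Chain m → Chain n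
push done     c σ             = c σ
push (keep θ) c (s ∷ σ)       = push θ (λ ρ → c (s ∷ ρ)) σ
push (skip θ) c (outside ∷ σ) = push θ c σ
push (skip θ) c (inside  ∷ σ) = 0ℚ

push-cong : ∀ {m n} (θ : Thinning m n) {c c′} → c ≗ c′ → push θ c ≗ push θ c′
push-cong done     eq σ             = eq σ
push-cong (keep θ) eq (s ∷ σ)       = push-cong θ (eq ∘ (s ∷_)) σ
push-cong (skip θ) eq (outside ∷ σ) = push-cong θ eq σ
push-cong (skip θ) eq (inside  ∷ σ) = refl

push-+ : ∀ {m n} (θ : Thinning m n) c c′ σ → push θ (λ ρ → c ρ ℚ.+ c′ ρ) σ ≡ push θ c σ ℚ.+ push θ c′ σ
push-+ done     c c′ σ             = refl
push-+ (keep θ) c c′ (s ∷ σ)       = push-+ θ (c ∘ (s ∷_)) (c′ ∘ (s ∷_)) σ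
push-+ (skip θ) c c′ (outside ∷ σ) = push-+ θ c c′ σ
push-+ (skip θ) c c′ (inside  ∷ σ) = refl

push-neg : ∀ {m n} (θ : Thinning m n) c σ → push θ (λ ρ → ℚ.- c ρ) σ ≡ ℚ.- push θ c σ
push-neg done     c σ             = refl
push-neg (keep θ) c (s ∷ σ)       = push-neg θ (c ∘ (s ∷_)) σ
push-neg (skip θ) c (outside ∷ σ) = push-neg θ c σ
push-neg (skip θ) c (inside  ∷ σ) = refl

push-image : ∀ {m n} (θ : Thinning m n) c σ → push θ c (image θ σ) ≡ c σ
push-image done     c σ       = refl
push-image (keep θ) c (s ∷ σ) = push-image θ (c ∘ (s ∷_)) σ
push-image (skip θ) c σ       = push-image θ c σ

push-vanishes : ∀ {m n} (θ : Thinning m n) {c} ρ → (∀ σ → ρ ≡ image θ σ → c σ ≡ 0ℚ) → push θ c ρ ≡ 0ℚ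
push-vanishes done     ρ             z = z ρ refl
push-vanishes (keep θ) (s ∷ ρ)       z = push-vanishes θ ρ (λ σ eq → z (s ∷ σ) (cong (s ∷_) eq))
push-vanishes (skip θ) (outside ∷ ρ) z = push-vanishes θ ρ (λ σ eq → z σ (cong (outside ∷_) eq))
push-vanishes (skip θ) (inside  ∷ ρ) z = refl

push-unique : ∀ {m n} (θ : Thinning m n) {c : Chain m} {e : Chain n} → (∀ σ → e (image θ σ) ≡ c σ) →
  (∀ ρ → (∀ σ → ρ ≢ image θ σ) → e ρ ≡ 0ℚ) → push θ c ≗ e
push-unique done     on off σ             = sym (on σ)
push-unique (keep θ) on off (s ∷ σ)       = push-unique θ (on ∘ (s ∷_))
  (λ ρ ρ∉ → off (s ∷ ρ) λ { (_ ∷ σ) refl → ρ∉ σ refl }) σ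
push-unique (skip θ) on off (outside ∷ σ) = push-unique θ on
  (λ ρ ρ∉ → off (outside ∷ ρ) λ { σ refl → ρ∉ σ refl }) σ
push-unique (skip θ) on off (inside  ∷ σ) = sym (off (inside ∷ σ) λ _ ())

∂-push : ∀ {m n} (θ : Thinning m n) c → ∂ (push θ c) ≗ push θ (∂ c)
∂-push done     c []            = refl
∂-push (keep θ) c (outside ∷ τ) = trans (∂-outside (push (keep θ) c) τ)
  (trans (cong (push θ (λ σ → c (inside ∷ σ)) τ ℚ.+_) (∂-push θ (λ σ → c (outside ∷ σ)) τ))
  (sym (trans (push-cong θ (∂-outside c) τ) (push-+ θ (c ∘ (inside ∷_)) (∂ (c ∘ (outside ∷_))) τ))))
∂-push (keep θ) c (inside ∷ τ)  = trans (∂-inside (push (keep θ) c) τ)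
  (trans (cong ℚ.-_ (∂-push θ (λ σ → c (inside ∷ σ)) τ))
  (sym (trans (push-cong θ (∂-inside c) τ) (push-neg θ (∂ (c ∘ (inside ∷_))) τ))))
∂-push (skip θ) c (outside ∷ τ) = trans (∂-outside (push (skip θ) c) τ) (trans (ℚ.+-identityˡ _) (∂-push θ c τ))
∂-push (skip θ) c (inside ∷ τ)  = trans (∂-inside (push (skip θ) c) τ) (cong ℚ.-_ (∂-zero (λ _ → refl) τ))

record Image {m n} (θ : Thinning m n) (K : Complex m) (K′ : Complex n) : Set where
  field
    to    : ∀ {σ} → Face K σ → Face K′ (image θ σ)
    from  : ∀ {σ} → Face K′ (image θ σ) → Face K σ
    onto  : ∀ {ρ} → Face K′ ρ → ∃ λ σ → ρ ≡ image θ σ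

module _ {m n} {θ : Thinning m n} {K : Complex m} {K′ : Complex n} (im : Image θ K K′) where
  open Image im

  pull : Chain n → Chain m
  pull c σ = c (image θ σ)

  pull-chain : ∀ {d c} → IsChain K′ d c → IsChain K d (pull c)
  pull-chain ch σ ¬f = ch (image θ σ) λ (f , eq) → ¬f (from f , trans (sym (∣image∣ θ σ)) eq)

  push-pull : ∀ {d c} → IsChain K′ d c → push θ (pull c) ≗ c
  push-pull ch = push-unique θ (λ _ → refl) (λ ρ ρ∉ → ch ρ λ (f , _) → let σ , eq = onto f in ρ∉ σ eq)

  ∂-pull : ∀ {d c} → IsChain K′ d c → ∂ (pull c) ≗ pull (∂ c)
  ∂-pull {c = c} ch σ = trans (sym (push-image θ (∂ (pull c)) σ))
    (trans (sym (∂-push θ (pull c) (image θ σ))) (∂-cong (push-pull ch) (image θ σ)))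

  push-chain : ∀ {d c} → IsChain K d c → IsChain K′ d (push θ c)
  push-chain ch ρ ¬f = push-vanishes θ ρ λ { σ refl → ch σ λ (f , eq) → ¬f (to f , trans (∣image∣ θ σ) eq) }

  image-acyclic : ∀ {t} → Acyclic K t → Acyclic K′ t
  image-acyclic H d d<t z (chz , ∂z) =
    fill (H d d<t (pull z) (pull-chain chz , λ τ → trans (∂-pull chz τ) (∂z (image θ τ))))
    where
    fill : IsBoundary K d (pull z) → IsBoundary K′ d z
    fill (b , chb , ∂b) = push θ b , push-chain chb ,
      λ τ → trans (∂-push θ b τ) (trans (push-cong θ ∂b τ) (push-pull chz τ))

  preimage-acyclic : ∀ {t} → Acyclic K′ t → Acyclic K t
  preimage-acyclic H d d<t z (chz , ∂z) =
    fill (H d d<t (push θ z) (push-chain chz , λ τ → trans (∂-push θ z τ) (push-vanishes θ τ (λ σ _ → ∂z σ))))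
    where
    fill : IsBoundary K′ d (push θ z) → IsBoundary K d z
    fill (b , chb , ∂b) = pull b , pull-chain chb ,
      λ τ → trans (∂-pull chb τ) (trans (∂b (image θ τ)) (push-image θ z τ))

-- Matroid rank

∪-least : ∀ {n} {p q r : Subset n} → p ⊆ r → q ⊆ r → p ∪ q ⊆ r
∪-least {p = p} {q} p⊆r q⊆r x∈ = [ p⊆r , q⊆r ]′ (x∈p∪q⁻ p q x∈)

∪-mono : ∀ {n} {p p′ q q′ : Subset n} → p ⊆ p′ → q ⊆ q′ → p ∪ q ⊆ p′ ∪ q′
∪-mono {p′ = p′} {q′ = q′} p⊆ q⊆ = ∪-least (⊆-trans p⊆ (p⊆p∪q q′)) (⊆-trans q⊆ (q⊆p∪q p′ q′))

⁅⁆⊆ : ∀ {n} {x : Fin n} {p} → x ∈ p → ⁅ x ⁆ ⊆ p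
⁅⁆⊆ {x = x} {p} x∈p y∈ = subst (_∈ p) (sym (x∈⁅y⁆⇒x≡y x y∈)) x∈p

∈∪⁅⁆⁻ : ∀ {n} {x y : Fin n} (p : Subset n) → x ∈ p ∪ ⁅ y ⁆ → x ∈ p ⊎ x ≡ y
∈∪⁅⁆⁻ {y = y} p x∈ with x∈p∪q⁻ p ⁅ y ⁆ x∈
... | inj₁ x∈p = inj₁ x∈p
... | inj₂ x∈y = inj₂ (x∈⁅y⁆⇒x≡y y x∈y)

y∈∪⁅y⁆ : ∀ {n} (p : Subset n) y → y ∈ p ∪ ⁅ y ⁆
y∈∪⁅y⁆ p y = q⊆p∪q p ⁅ y ⁆ (x∈⁅x⁆ y)

x∈q⇒x∉p─q : ∀ {n} {x : Fin n} (p : Subset n) {q} → x ∈ q → x ∉ p ─ q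
x∈q⇒x∉p─q (_ ∷ p) here        ()
x∈q⇒x∉p─q (_ ∷ p) (there x∈q) (there x∈) = x∈q⇒x∉p─q p x∈q x∈

x∈p-y⇒x≢y : ∀ {n} {x y : Fin n} (p : Subset n) → x ∈ p - y → x ≢ y
x∈p-y⇒x≢y {x = x} p x∈ refl = x∈q⇒x∉p─q p (x∈⁅x⁆ x) x∈

x∈p-y⇒x∈p : ∀ {n} {x y : Fin n} (p : Subset n) → x ∈ p - y → x ∈ p
x∈p-y⇒x∈p {y = y} p = p─q⊆p p ⁅ y ⁆

[p-x]∪⁅x⁆≡p : ∀ {n} {x : Fin n} (p : Subset n) → x ∈ p → (p - x) ∪ ⁅ x ⁆ ≡ p
[p-x]∪⁅x⁆≡p {x = x} p x∈p = ⊆-antisym (∪-least (p─q⊆p p ⁅ x ⁆) (⁅⁆⊆ x∈p)) back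
  where
  back : p ⊆ (p - x) ∪ ⁅ x ⁆
  back {y} y∈p with y Fin.≟ x
  ... | yes refl = y∈∪⁅y⁆ (p - x) x
  ... | no  y≢x  = p⊆p∪q ⁅ x ⁆ (x∈p∧x≢y⇒x∈p-y y∈p y≢x)

∣p∣≡1+∣p-x∣ : ∀ {n} {x : Fin n} (p : Subset n) → x ∈ p → ∣ p ∣ ≡ suc ∣ p - x ∣
∣p∣≡1+∣p-x∣ p x∈p = trans (cong ∣_∣ (sym ([p-x]∪⁅x⁆≡p p x∈p)))
  (∣p∪⁅x⁆∣≡1+∣p∣ (p - _) (λ x∈ → x∈p-y⇒x≢y p x∈ refl))

p⊆q∧∣q∣≤∣p∣⇒q⊆p : ∀ {n} {p q : Subset n} → p ⊆ q → ∣ q ∣ ≤ ∣ p ∣ → q ⊆ p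
p⊆q∧∣q∣≤∣p∣⇒q⊆p {p = p} p⊆q ∣q∣≤∣p∣ {x} x∈q with x ∈? p
... | yes x∈p = x∈p
... | no  x∉p = contradiction ∣q∣≤∣p∣ (ℕ.<⇒≱ (p⊂q⇒∣p∣<∣q∣ (p⊆q , x , x∈q , x∉p)))

module _ {n : ℕ} (M : Matroid n) where

  ∣A∣≤rank : ∀ {A} → Indep M A → ∣ A ∣ ≤ rank M
  ∣A∣≤rank {A} A∈M = All.lookup (xs≤max 0 _) (∈-map⁺ ∣_∣ (∈-filter⁺ (indep? M) (∈-subsets A) A∈M))

  rank-attained : ∃ λ A → Indep M A × ∣ A ∣ ≡ rank M
  rank-attained with argmax-sel id 0 (map ∣_∣ (filter (indep? M) (subsets n)))
  ... | inj₁ max≡0 = ⊥ , ∅-face (independent M) , trans (∣⊥∣≡0 n) (sym max≡0)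
  ... | inj₂ max∈ with ∈-map⁻ ∣_∣ max∈
  ...   | A , A∈ , eq = A , proj₂ (∈-filter⁻ (indep? M) {xs = subsets n} A∈) , sym eq

module Rank {n : ℕ} (M : Matroid n) where

  r : Subset n → ℕ
  r X = rank (M ↾ᴹ X)

  ∣A∣≤r : ∀ {A X} → Indep M A → A ⊆ X → ∣ A ∣ ≤ r X
  ∣A∣≤r {X = X} A∈M A⊆X = ∣A∣≤rank (M ↾ᴹ X) (A∈M , A⊆X)

  r-attained : ∀ X → ∃ λ A → Indep M A × A ⊆ X × ∣ A ∣ ≡ r X
  r-attained X with rank-attained (M ↾ᴹ X)
  ... | A , (A∈M , A⊆X) , eq = A , A∈M , A⊆X , eq

  r-mono : ∀ {X Y} → X ⊆ Y → r X ≤ r Y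
  r-mono {X} X⊆Y with r-attained X
  ... | A , A∈M , A⊆X , eq = subst (_≤ _) eq (∣A∣≤r A∈M (⊆-trans A⊆X X⊆Y))

  rank≤r⊤ : rank M ≤ r ⊤
  rank≤r⊤ with rank-attained M
  ... | A , A∈M , eq = subst (_≤ r ⊤) eq (∣A∣≤r A∈M (⊆-max A))

  r-∪⁅⁆ : ∀ X v → r (X ∪ ⁅ v ⁆) ≤ suc (r X)
  r-∪⁅⁆ X v with r-attained (X ∪ ⁅ v ⁆)
  ... | A , A∈M , A⊆Xv , eq = subst (_≤ suc (r X)) eq bound
    where
    bound : ∣ A ∣ ≤ suc (r X)
    bound with v ∈? A
    ... | yes v∈A = subst (_≤ suc (r X)) (sym (∣p∣≡1+∣p-x∣ A v∈A))
            (s≤s (∣A∣≤r (down-closed (independent M) (p─q⊆p A ⁅ v ⁆) A∈M) λ x∈ →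
              [ id , (λ x≡v → contradiction x≡v (x∈p-y⇒x≢y A x∈)) ]′ (∈∪⁅⁆⁻ X (A⊆Xv (x∈p-y⇒x∈p A x∈)))))
    ... | no v∉A = ℕ.m≤n⇒m≤1+n (∣A∣≤r A∈M λ x∈ →
            [ id , (λ x≡v → contradiction (subst (_∈ A) x≡v x∈) v∉A) ]′ (∈∪⁅⁆⁻ X (A⊆Xv x∈)))

  extend : ∀ {A X} → Indep M A → A ⊆ X → ∀ j → ∣ A ∣ + j ≤ r X →
           ∃ λ B → Indep M B × A ⊆ B × B ⊆ X × ∣ B ∣ ≡ ∣ A ∣ + j
  extend {A} A∈M A⊆X zero    _ = A , A∈M , id , A⊆X , sym (ℕ.+-identityʳ ∣ A ∣)
  extend {A} {X} A∈M A⊆X (suc j) ≤r with r-attained X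
  ... | D , D∈M , D⊆X , ∣D∣≡r
    with augment M A∈M D∈M (ℕ.≤-trans (ℕ.≤-trans (ℕ.m≤m+n (suc ∣ A ∣) j) (ℕ.≤-reflexive (sym (ℕ.+-suc ∣ A ∣ j)))) (subst (_ ≤_) (sym ∣D∣≡r) ≤r))
  ... | x , x∈D , x∉A , Ax∈M
    with extend Ax∈M (∪-least A⊆X (⁅⁆⊆ (D⊆X x∈D))) j (subst (_≤ r X) size ≤r)
    where
    size : ∣ A ∣ + suc j ≡ ∣ A ∪ ⁅ x ⁆ ∣ + j
    size = trans (ℕ.+-suc ∣ A ∣ j) (cong (_+ j) (sym (∣p∪⁅x⁆∣≡1+∣p∣ A x∉A)))
  ... | B , B∈M , Ax⊆B , B⊆X , ∣B∣≡ = B , B∈M , ⊆-trans (p⊆p∪q ⁅ x ⁆) Ax⊆B , B⊆X ,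
        trans ∣B∣≡ (trans (cong (_+ j) (∣p∪⁅x⁆∣≡1+∣p∣ A x∉A)) (sym (ℕ.+-suc ∣ A ∣ j)))

  -- This is monotonicity of closure. A maximum independent set `B` of `Y` is grown from one `A` of
  -- `Z`. If `v` raised the rank of `Y`, then `B` could be augmented either inside `Y`, against its
  -- maximality, or by `v`; in the latter case `v` would also extend `A`.
  r-closure : ∀ {Z Y} v → Z ⊆ Y → r (Z ∪ ⁅ v ⁆) ≤ r Z → r (Y ∪ ⁅ v ⁆) ≤ r Y
  r-closure {Z} {Y} v Z⊆Y rZv≤rZ with r-attained Z
  ... | A , A∈M , A⊆Z , ∣A∣≡rZ
    with extend A∈M (⊆-trans A⊆Z Z⊆Y) (r Y ∸ ∣ A ∣) (ℕ.≤-reflexive (ℕ.m+[n∸m]≡n (∣A∣≤r A∈M (⊆-trans A⊆Z Z⊆Y))))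
  ... | B , B∈M , A⊆B , B⊆Y , ∣B∣≡ with r (Y ∪ ⁅ v ⁆) ≤? r Y | r-attained (Y ∪ ⁅ v ⁆)
  ... | yes ok | _ = ok
  ... | no ¬ok | D , D∈M , D⊆Yv , ∣D∣≡ = Empty.⊥-elim absurd
    where
    ∣B∣≡rY = trans ∣B∣≡ (ℕ.m+[n∸m]≡n (∣A∣≤r A∈M (⊆-trans A⊆Z Z⊆Y)))
    absurd : Empty.⊥
    absurd with augment M B∈M D∈M (ℕ.≤-trans (ℕ.≤-trans (s≤s (ℕ.≤-reflexive ∣B∣≡rY)) (ℕ.≰⇒> ¬ok)) (ℕ.≤-reflexive (sym ∣D∣≡)))
    ... | x , x∈D , x∉B , Bx∈M with ∈∪⁅⁆⁻ Y (D⊆Yv x∈D)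
    ...   | inj₁ x∈Y = ℕ.<⇒≱ (ℕ.≤-reflexive (trans (cong suc (sym ∣B∣≡rY)) (sym (∣p∪⁅x⁆∣≡1+∣p∣ B x∉B))))
                         (∣A∣≤r Bx∈M (∪-least B⊆Y (⁅⁆⊆ x∈Y)))
    ...   | inj₂ refl = ℕ.<⇒≱ (ℕ.≤-reflexive (trans (cong suc (sym ∣A∣≡rZ)) (sym (∣p∪⁅x⁆∣≡1+∣p∣ A (x∉B ∘ A⊆B)))))
                         (ℕ.≤-trans (∣A∣≤r (down-closed (independent M) (∪-mono A⊆B id) Bx∈M) (∪-mono A⊆Z id)) rZv≤rZ)

  spans⇒containsBasis : ∀ {k σ} → k ≤ r σ → ContainsBasis (truncate M k) σ
  spans⇒containsBasis {k} {σ} k≤rσ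
    with extend (∅-face (independent M)) (⊆-min σ) k (subst (λ e → e + k ≤ r σ) (sym (∣⊥∣≡0 n)) k≤rσ)
  ... | B , B∈M , _ , B⊆σ , ∣B∣≡ = B , ((B∈M , ℕ.≤-reflexive ∣B∣≡k) ,
        λ A (_ , ∣A∣≤k) B⊆A → p⊆q∧∣q∣≤∣p∣⇒q⊆p B⊆A (ℕ.≤-trans ∣A∣≤k (ℕ.≤-reflexive (sym ∣B∣≡k)))) , B⊆σ
    where
    ∣B∣≡k : ∣ B ∣ ≡ k
    ∣B∣≡k = trans ∣B∣≡ (cong (_+ k) (∣⊥∣≡0 n))

  -- A basis of the truncation with fewer than `k` elements could be augmented from a maximum
  -- independent set of `M`. With `spans⇒containsBasis` this identifies the vertices of `Int≤ C M k`
  -- as the faces of `C` of rank at least `k`.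
  containsBasis⇒spans : ∀ {k σ} → k ≤ rank M → ContainsBasis (truncate M k) σ → k ≤ r σ
  containsBasis⇒spans {k} {σ} k≤rank (B , ((B∈M , ∣B∣≤k) , maximal) , B⊆σ) with k ≤? ∣ B ∣ | rank-attained M
  ... | yes k≤∣B∣ | _ = ℕ.≤-trans k≤∣B∣ (∣A∣≤r B∈M B⊆σ)
  ... | no  k≰∣B∣ | D , D∈M , ∣D∣≡ with augment M B∈M D∈M (ℕ.≤-trans (ℕ.≰⇒> k≰∣B∣) (ℕ.≤-trans k≤rank (ℕ.≤-reflexive (sym ∣D∣≡))))
  ...   | x , _ , x∉B , Bx∈M = contradiction
          (maximal (B ∪ ⁅ x ⁆) (Bx∈M , ℕ.≤-trans (∣A∪⁅x⁆∣≤1+∣A∣ B x) (ℕ.≰⇒> k≰∣B∣)) (p⊆p∪q ⁅ x ⁆) (y∈∪⁅y⁆ B x)) x∉B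

-- Fibre lemmas

module _ {n : ℕ} (K : Complex n) where

  deletion : Fin n → Complex n
  deletion a .Face S = Face K S × a ∉ S
  deletion a .face? S = face? K S ×-dec ¬? (a ∈? S)
  deletion a .∅-face = ∅-face K , ∉⊥
  deletion a .down-closed S⊆T (T∈K , a∉T) = down-closed K S⊆T T∈K , a∉T ∘ S⊆T

  deletions : List (Fin n) → Complex n
  deletions as .Face S = Face K S × All (_∉ S) as
  deletions as .face? S = face? K S ×-dec All.all? (λ a → ¬? (a ∈? S)) as
  deletions as .∅-face = ∅-face K , All.universal (λ _ → ∉⊥) as
  deletions as .down-closed S⊆T (T∈K , as∉T) = down-closed K S⊆T T∈K , All.map (λ a∉T → a∉T ∘ S⊆T) as∉T

  closedStar : ∀ {x} → Face K x → Complex n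
  closedStar {x} x∈K .Face S = Face K (S ∪ x)
  closedStar {x} x∈K .face? S = face? K (S ∪ x)
  closedStar {x} x∈K .∅-face = down-closed K (∪-least (⊆-min x) id) x∈K
  closedStar {x} x∈K .down-closed S⊆T = down-closed K (∪-mono S⊆T id)

module _ {n : ℕ} {K : Complex n} where

  closedStar-acyclic : ∀ {a} (a∈K : Face K ⁅ a ⁆) t → Acyclic (closedStar K a∈K) t
  closedStar-acyclic {a} a∈K = cone-acyclic (closedStar K a∈K) a
    (down-closed K (∪-least id (q⊆p∪q _ ⁅ a ⁆)))

  -- The two parts meet in the link of `a`, which is its closed star with `a` deleted.
  star-cover : ∀ {a} (a∈K : Face K ⁅ a ⁆) →
               Cover K (deletion K a) (closedStar K a∈K) (deletion (closedStar K a∈K) a)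
  star-cover {a} a∈K = record
    { A⊆K   = proj₁
    ; B⊆K   = down-closed K (p⊆p∪q ⁅ a ⁆)
    ; K⊆A∪B = split
    ; I⊆A   = λ (f , a∉S) → down-closed K (p⊆p∪q ⁅ a ⁆) f , a∉S
    ; I⊆B   = proj₁
    ; A∩B⊆I = λ (_ , a∉S) f → f , a∉S
    }
    where
    split : ∀ {S} → Face K S → Face (deletion K a) S ⊎ Face K (S ∪ ⁅ a ⁆)
    split {S} f with a ∈? S
    ... | yes a∈S = inj₂ (down-closed K (∪-least id (⁅⁆⊆ a∈S)) f)
    ... | no  a∉S = inj₁ (f , a∉S)

-- A homological form of Quillen's fibre lemma: attaching the vertices as to
-- deletions K as one after the other attaches cones over acyclic links.
acyclic-fibres : ∀ {n} (as : List (Fin n)) (K : Complex n) {t} → Acyclic (deletions K as) t →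
  (∀ {x} (x∈K : Face K x) → Nonempty x → (∀ {a} → a ∈ x → a ∈ᴸ as) → ∀ s → Acyclic (deletions (closedStar K x∈K) as) s) →
  Acyclic K t
acyclic-fibres []       K H _ = acyclic-resp {K = deletions K []} {K} proj₁ (λ f → f , []) H
acyclic-fibres (a ∷ as) K {zero}  H links = λ _ ()
acyclic-fibres (a ∷ as) K {suc t} H links = attach (face? K ⁅ a ⁆)
  where
  deleted : Acyclic (deletion K a) (suc t)
  deleted = acyclic-fibres as (deletion K a)
    (acyclic-resp {K = deletions K (a ∷ as)} {deletions (deletion K a) as}
      (λ { (f , a∉S ∷ as∉S) → (f , a∉S) , as∉S }) (λ ((f , a∉S) , as∉S) → f , a∉S ∷ as∉S) H)
    -- For `x` without `a`, deleting `a` before or after forming the closed star gives the same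
    -- fibre.
    (λ {x} (x∈K , a∉x) ne x⊆as s → acyclic-resp
      {K = deletions (closedStar K x∈K) (a ∷ as)} {deletions (closedStar (deletion K a) (x∈K , a∉x)) as}
      (λ { {S} (f , a∉S ∷ as∉S) → (f , λ a∈ → [ a∉S , a∉x ]′ (x∈p∪q⁻ S x a∈)) , as∉S })
      (λ ((f , a∉Sx) , as∉S) → f , (a∉Sx ∘ p⊆p∪q x) ∷ as∉S)
      (links x∈K ne (there ∘ x⊆as) s))
  attach : Dec (Face K ⁅ a ⁆) → Acyclic K (suc t)
  attach (no a∉K) = acyclic-resp {K = deletion K a} {K} proj₁
    (λ f → f , λ a∈S → a∉K (down-closed K (⁅⁆⊆ a∈S) f)) deleted
  attach (yes a∈K) = MayerVietoris.union (star-cover {K = K} a∈K) deleted (closedStar-acyclic {K = K} a∈K (suc t)) link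
    where
    Lk : Complex _
    Lk = deletion (closedStar K a∈K) a
    link : Acyclic Lk t
    -- For the link of `a`, the base is the fibre of `K` over `⁅ a ⁆`, and the fibre over `x` is
    -- that of `K` over `x ∪ ⁅ a ⁆`.
    link = acyclic-fibres as Lk
      (acyclic-resp {K = deletions (closedStar K a∈K) (a ∷ as)} {deletions Lk as}
        (λ { (f , a∉S ∷ as∉S) → (f , a∉S) , as∉S }) (λ ((f , a∉S) , as∉S) → f , a∉S ∷ as∉S)
        (links a∈K (a , x∈⁅x⁆ a) (λ b∈ → here (x∈⁅y⁆⇒x≡y a b∈)) t))
      (λ {x} (xa∈K , a∉x) ne x⊆as s → acyclic-resp
        {K = deletions (closedStar K xa∈K) (a ∷ as)} {deletions (closedStar Lk (xa∈K , a∉x)) as}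
        (λ { {S} (f , a∉S ∷ as∉S) → (subst (Face K) (sym (∪-assoc S x ⁅ a ⁆)) f ,
               λ a∈ → [ a∉S , a∉x ]′ (x∈p∪q⁻ S x a∈)) , as∉S })
        (λ {S} ((f , a∉Sx) , as∉S) → subst (Face K) (∪-assoc S x ⁅ a ⁆) f , (a∉Sx ∘ p⊆p∪q x) ∷ as∉S)
        (links xa∈K (a , y∈∪⁅y⁆ x a) (λ b∈ → [ there ∘ x⊆as , here ]′ (∈∪⁅⁆⁻ x b∈)) s))

-- The binary number whose digits are the membership bits, the first point being the lowest. It is
-- monotone and injective, so it refines inclusion to a linear order.
code : ∀ {n} → Subset n → ℕ
code []            = 0
code (outside ∷ S) = code S + code S
code (inside  ∷ S) = suc (code S + code S)

code-mono : ∀ {n} {S T : Subset n} → S ⊆ T → code S ≤ code T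
code-mono {S = []} {[]} _ = z≤n
code-mono {S = outside ∷ S} {outside ∷ T} S⊆T = ℕ.+-mono-≤ (code-mono (drop-∷-⊆ S⊆T)) (code-mono (drop-∷-⊆ S⊆T))
code-mono {S = outside ∷ S} {inside  ∷ T} S⊆T = ℕ.m≤n⇒m≤1+n (ℕ.+-mono-≤ (code-mono (drop-∷-⊆ S⊆T)) (code-mono (drop-∷-⊆ S⊆T)))
code-mono {S = inside  ∷ S} {outside ∷ T} S⊆T with S⊆T Vec.here
... | ()
code-mono {S = inside  ∷ S} {inside  ∷ T} S⊆T = s≤s (ℕ.+-mono-≤ (code-mono (drop-∷-⊆ S⊆T)) (code-mono (drop-∷-⊆ S⊆T)))

m+m-injective : ∀ {m n} → m + m ≡ n + n → m ≡ n
m+m-injective {zero}  {zero}  _  = refl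
m+m-injective {suc m} {suc n} eq = cong suc (m+m-injective (ℕ.suc-injective
  (trans (sym (ℕ.+-suc m m)) (trans (ℕ.suc-injective eq) (ℕ.+-suc n n)))))

m+m≢1+n+n : ∀ {m n} → m + m ≢ suc (n + n)
m+m≢1+n+n {suc m} {zero}  eq with trans (sym (ℕ.+-suc m m)) (ℕ.suc-injective eq)
... | ()
m+m≢1+n+n {suc m} {suc n} eq = m+m≢1+n+n {m} {n} (ℕ.suc-injective
  (trans (sym (ℕ.+-suc m m)) (trans (ℕ.suc-injective eq) (cong suc (ℕ.+-suc n n)))))

code-injective : ∀ {n} {S T : Subset n} → code S ≡ code T → S ≡ T
code-injective {S = []} {[]} _ = refl
code-injective {S = outside ∷ S} {outside ∷ T} eq = cong (outside ∷_) (code-injective (m+m-injective eq))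
code-injective {S = outside ∷ S} {inside  ∷ T} eq = contradiction eq (m+m≢1+n+n {code S} {code T})
code-injective {S = inside  ∷ S} {outside ∷ T} eq = contradiction (sym eq) (m+m≢1+n+n {code T} {code S})
code-injective {S = inside  ∷ S} {inside  ∷ T} eq = cong (inside ∷_) (code-injective (m+m-injective (ℕ.suc-injective eq)))

-- Deleting the faces whose trace on B is bad. The bad traces s are removed one
-- at a time, largest code first; each removal takes away the interior of the
-- join of s with a cone.
module BadFaces {n : ℕ} (K : Complex n) (B : Subset n) {Bad : Pred (Subset n) 0ℓ} (bad? : Decidable Bad)
  (bad-up : ∀ {S T} → S ⊆ T → Bad S → Bad T) (bad-trace : ∀ {S} → Bad S → Bad (S ∩ B)) (∅-good : ¬ Bad ⊥)
  (apex : ∀ {s} → Face K s → Bad s → s ⊆ B →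
    ∃ λ a → a ∉ B × (∀ {S} → S ∩ B ⊆ s → Face K (S ∪ s) → Face K ((S ∪ ⁅ a ⁆) ∪ s))) where

  good : Complex n
  good .Face S = Face K S × ¬ Bad S
  good .face? S = face? K S ×-dec ¬? (bad? S)
  good .∅-face = ∅-face K , ∅-good
  good .down-closed S⊆T (T∈K , ¬bad) = down-closed K S⊆T T∈K , ¬bad ∘ bad-up S⊆T

  trace-mono : ∀ {S T} → S ⊆ T → S ∩ B ⊆ T ∩ B
  trace-mono {S} S⊆T x∈ = let x∈S , x∈B = x∈p∩q⁻ S B x∈ in x∈p∩q⁺ (S⊆T x∈S , x∈B)

  -- A filtration from the good faces, at `j = 0`, up to `K`, at `j = suc (code B)`.
  below : ℕ → Complex n
  below j .Face S = Face K S × (Bad S → code (S ∩ B) < j)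
  below j .face? S = face? K S ×-dec (bad? S →-dec (code (S ∩ B) ℕ.<? j))
  below j .∅-face = ∅-face K , λ bad → contradiction bad ∅-good
  below j .down-closed S⊆T (T∈K , lt) = down-closed K S⊆T T∈K ,
    λ bad → ℕ.≤-<-trans (code-mono (trace-mono S⊆T)) (lt (bad-up S⊆T bad))

  remove : ∀ j {t} → Acyclic (below (suc j)) t → Acyclic (below j) t
  remove j {t} H = go (anySubset? (λ s → face? K s ×-dec bad? s ×-dec (s ⊆? B) ×-dec (code s ℕ.≟ j)))
    where
    go : Dec (∃ λ s → Face K s × Bad s × s ⊆ B × code s ≡ j) → Acyclic (below j) t
    go (no none) = acyclic-resp {K = below (suc j)} {below j}
      (λ {S} (f , lt) → f , λ bad → ℕ.≤∧≢⇒< (s≤s⁻¹ (lt bad)) λ eq →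
        none (S ∩ B , down-closed K (p∩q⊆p S B) f , bad-trace bad , p∩q⊆q S B , eq))
      (λ (f , lt) → f , ℕ.m≤n⇒m≤1+n ∘ lt) H
    go (yes (s , s∈K , bad-s , s⊆B , code≡j)) with apex s∈K bad-s s⊆B
    ... | a , a∉B , closed = MayerVietoris.part cover H (cone-acyclic I a I-cone t)
      where
      -- The faces of `below (suc j)` outside `below j` have trace `s`, so they lie in `block`. As
      -- `a` is not in `B`, adding it changes no trace, and the intersection with `below j` is still
      -- a cone with apex `a`.
      block : Complex n
      block .Face S = S ∩ B ⊆ s × Face K (S ∪ s)
      block .face? S = (S ∩ B ⊆? s) ×-dec face? K (S ∪ s)
      block .∅-face = (λ x∈ → contradiction (p∩q⊆p ⊥ B x∈) ∉⊥) , down-closed K (∪-least (⊆-min s) id) s∈K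
      block .down-closed S⊆T (T∩B⊆s , f) = ⊆-trans (trace-mono S⊆T) T∩B⊆s , down-closed K (∪-mono S⊆T id) f
      I : Complex n
      I .Face S = Face (below j) S × Face block S
      I .face? S = face? (below j) S ×-dec face? block S
      I .∅-face = ∅-face (below j) , ∅-face block
      I .down-closed S⊆T (f , g) = down-closed (below j) S⊆T f , down-closed block S⊆T g
      split : ∀ {S} → Face (below (suc j)) S → Face (below j) S ⊎ Face block S
      split {S} (f , lt) with bad? S | code (S ∩ B) ℕ.≟ j
      ... | no ¬bad | _      = inj₁ (f , λ bad → contradiction bad ¬bad)
      ... | yes bad | no ≢j  = inj₁ (f , λ bad → ℕ.≤∧≢⇒< (s≤s⁻¹ (lt bad)) ≢j)
      ... | yes bad | yes ≡j = inj₂ (⊆-reflexive S∩B≡s ,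
              down-closed K (∪-least id (⊆-trans (⊆-reflexive (sym S∩B≡s)) (p∩q⊆p S B))) f)
        where
        S∩B≡s : S ∩ B ≡ s
        S∩B≡s = code-injective (trans ≡j (sym code≡j))
      cover : Cover (below (suc j)) (below j) block I
      cover = record
        { A⊆K   = λ (f , lt) → f , ℕ.m≤n⇒m≤1+n ∘ lt
        ; B⊆K   = λ (S∩B⊆s , f) → down-closed K (p⊆p∪q s) f ,
                    λ _ → s≤s (ℕ.≤-trans (code-mono S∩B⊆s) (ℕ.≤-reflexive code≡j))
        ; K⊆A∪B = split
        ; I⊆A   = proj₁
        ; I⊆B   = proj₂
        ; A∩B⊆I = _,_
        }
      trace-∪a : ∀ S → (S ∪ ⁅ a ⁆) ∩ B ⊆ S ∩ B
      trace-∪a S x∈ with x∈p∩q⁻ (S ∪ ⁅ a ⁆) B x∈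
      ... | x∈Sa , x∈B with ∈∪⁅⁆⁻ S x∈Sa
      ...   | inj₁ x∈S  = x∈p∩q⁺ (x∈S , x∈B)
      ...   | inj₂ refl = contradiction x∈B a∉B
      I-cone : ∀ {S} → Face I S → Face I (S ∪ ⁅ a ⁆)
      I-cone {S} ((f , lt) , S∩B⊆s , g) =
        (down-closed K (p⊆p∪q s) (closed S∩B⊆s g) , λ bad → ℕ.≤-<-trans (code-mono (trace-∪a S))
          (lt (bad-up (⊆-trans (trace-∪a S) (p∩q⊆p S B)) (bad-trace bad)))) ,
        ⊆-trans (trace-∪a S) S∩B⊆s , closed S∩B⊆s g

  good-acyclic : ∀ {t} → Acyclic K t → Acyclic good t
  good-acyclic {t} H = acyclic-resp {K = below 0} {good}
    (λ (f , lt) → f , λ bad → ℕ.n≮0 (lt bad)) (λ (f , ¬bad) → f , λ bad → contradiction bad ¬bad)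
    (removeAll (suc (code B)) (acyclic-resp {K = K} {below (suc (code B))}
      (λ {S} f → f , λ _ → s≤s (code-mono (p∩q⊆q S B))) proj₁ H))
    where
    removeAll : ∀ j → Acyclic (below j) t → Acyclic (below 0) t
    removeAll zero    H = H
    removeAll (suc j) H = removeAll j (remove j H)

-- Complexes of triples (σ , τ , x)

embed : ∀ {m n} → Thinning m n → Fin m → Fin n
embed (keep θ) zero    = zero
embed (keep θ) (suc v) = suc (embed θ v)
embed (skip θ) v       = suc (embed θ v)

∈-image⁺ : ∀ {m n} (θ : Thinning m n) {v σ} → v ∈ σ → embed θ v ∈ image θ σ
∈-image⁺ (keep θ) here        = here
∈-image⁺ (keep θ) (there v∈σ) = there (∈-image⁺ θ v∈σ)
∈-image⁺ (skip θ) v∈σ         = there (∈-image⁺ θ v∈σ)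

∈-image⁻ : ∀ {m n} (θ : Thinning m n) {w} σ → w ∈ image θ σ → ∃ λ v → v ∈ σ × w ≡ embed θ v
∈-image⁻ (keep θ) (_ ∷ σ) here        = zero , here , refl
∈-image⁻ (keep θ) (_ ∷ σ) (there w∈) with ∈-image⁻ θ σ w∈
... | v , v∈σ , eq = suc v , there v∈σ , cong suc eq
∈-image⁻ (skip θ) σ       (there w∈) with ∈-image⁻ θ σ w∈
... | v , v∈σ , eq = v , v∈σ , cong suc eq

noneᵗ : ∀ n → Thinning 0 n
noneᵗ zero    = done
noneᵗ (suc n) = skip (noneᵗ n)

allᵗ : ∀ n → Thinning n n
allᵗ zero    = done
allᵗ (suc n) = keep (allᵗ n)

leftᵗ : ∀ m n → Thinning m (m + n)
leftᵗ zero    n = noneᵗ n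
leftᵗ (suc m) n = keep (leftᵗ m n)

rightᵗ : ∀ m {l n} → Thinning l n → Thinning l (m + n)
rightᵗ zero    θ = θ
rightᵗ (suc m) θ = skip (rightᵗ m θ)

embed-all : ∀ {n} (v : Fin n) → embed (allᵗ n) v ≡ v
embed-all zero    = refl
embed-all (suc v) = cong suc (embed-all v)

embed-left : ∀ {m} n (v : Fin m) → embed (leftᵗ m n) v ≡ v ↑ˡ n
embed-left n zero    = refl
embed-left n (suc v) = cong suc (embed-left n v)

embed-right : ∀ m {l n} (θ : Thinning l n) v → embed (rightᵗ m θ) v ≡ m ↑ʳ embed θ v
embed-right zero    θ v = refl
embed-right (suc m) θ v = cong suc (embed-right m θ v)

abstract
  preimage : ∀ {m n} → (Fin m → Fin n) → Subset n → Subset m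
  preimage ι S = tabulate (λ v → Vec.lookup S (ι v))

  ∈-preimage⁺ : ∀ {m n} (ι : Fin m → Fin n) {v S} → ι v ∈ S → v ∈ preimage ι S
  ∈-preimage⁺ ι {v} ιv∈S = Vec.lookup⇒[]= v _ (trans (Vec.lookup∘tabulate _ v) (Vec.[]=⇒lookup ιv∈S))

  ∈-preimage⁻ : ∀ {m n} (ι : Fin m → Fin n) {v S} → v ∈ preimage ι S → ι v ∈ S
  ∈-preimage⁻ ι {v} {S} v∈ = Vec.lookup⇒[]= (ι v) S (trans (sym (Vec.lookup∘tabulate _ v)) (Vec.[]=⇒lookup v∈))

module _ {m n : ℕ} (ι : Fin m → Fin n) where

  preimage-mono : ∀ {S T} → S ⊆ T → preimage ι S ⊆ preimage ι T
  preimage-mono S⊆T = ∈-preimage⁺ ι ∘ S⊆T ∘ ∈-preimage⁻ ι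

  preimage-∪ : ∀ S T → preimage ι (S ∪ T) ⊆ preimage ι S ∪ preimage ι T
  preimage-∪ S T v∈ = x∈p∪q⁺ ([ inj₁ ∘ ∈-preimage⁺ ι , inj₂ ∘ ∈-preimage⁺ ι ]′ (x∈p∪q⁻ S T (∈-preimage⁻ ι v∈)))

  preimage-⊥ : preimage ι ⊥ ⊆ ⊥
  preimage-⊥ v∈ = contradiction (∈-preimage⁻ ι v∈) ∉⊥

  preimage-∪⁅⁆ : (∀ {u v} → ι u ≡ ι v → u ≡ v) → ∀ S v → preimage ι (S ∪ ⁅ ι v ⁆) ⊆ preimage ι S ∪ ⁅ v ⁆
  preimage-∪⁅⁆ inj S v u∈ with ∈∪⁅⁆⁻ S (∈-preimage⁻ ι u∈)
  ... | inj₁ ιu∈S = p⊆p∪q ⁅ v ⁆ (∈-preimage⁺ ι ιu∈S)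
  ... | inj₂ eq with inj eq
  ...   | refl = y∈∪⁅y⁆ _ v

  preimage-∪-disjoint : ∀ {T} → (∀ v → ι v ∉ T) → ∀ S → preimage ι (S ∪ T) ⊆ preimage ι S
  preimage-∪-disjoint {T} ∉T S = ⊆-trans (preimage-∪ S T)
    (∪-least id λ v∈ → contradiction (∈-preimage⁻ ι v∈) (∉T _))

  preimage-∪⁅⁆-disjoint : ∀ {b} → (∀ v → ι v ≢ b) → ∀ S → preimage ι (S ∪ ⁅ b ⁆) ⊆ preimage ι S
  preimage-∪⁅⁆-disjoint ≢b = preimage-∪-disjoint (λ v → x≢y⇒x∉⁅y⁆ (≢b v))

preimage-image-disjoint : ∀ {l m n} (θ : Thinning m n) (κ : Fin l → Fin n) →
  (∀ v w → κ v ≢ embed θ w) → ∀ σ → preimage κ (image θ σ) ⊆ ⊥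
preimage-image-disjoint θ κ disjoint σ {v} v∈ with ∈-image⁻ θ σ (∈-preimage⁻ κ v∈)
... | w , _ , eq = contradiction eq (disjoint v w)

module _ {m n : ℕ} (θ : Thinning m n) (ι : Fin m → Fin n) (embed≡ι : ∀ v → embed θ v ≡ ι v) where

  preimage-image : (∀ {u v} → ι u ≡ ι v → u ≡ v) → ∀ σ → preimage ι (image θ σ) ⊆ σ
  preimage-image inj σ v∈ with ∈-image⁻ θ σ (∈-preimage⁻ ι v∈)
  ... | u , u∈σ , eq = subst (_∈ σ) (sym (inj (trans eq (embed≡ι u)))) u∈σ

  ⊆-preimage-image : ∀ σ → σ ⊆ preimage ι (image θ σ)
  ⊆-preimage-image σ {v} v∈σ = ∈-preimage⁺ ι (subst (_∈ image θ σ) (embed≡ι v) (∈-image⁺ θ v∈σ))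

  image-preimage : ∀ ρ → (∀ {j} → j ∈ ρ → ∃ λ v → j ≡ ι v) → ρ ≡ image θ (preimage ι ρ)
  image-preimage ρ range = ⊆-antisym to from
    where
    to : ρ ⊆ image θ (preimage ι ρ)
    to j∈ρ with range j∈ρ
    ... | v , refl = subst (_∈ image θ (preimage ι ρ)) (embed≡ι v) (∈-image⁺ θ (∈-preimage⁺ ι j∈ρ))
    from : image θ (preimage ι ρ) ⊆ ρ
    from j∈ with ∈-image⁻ θ (preimage ι ρ) j∈
    ... | v , v∈ , refl = subst (_∈ ρ) (sym (embed≡ι v)) (∈-preimage⁻ ι v∈)

-- The ground set carries two copies of the n points of C and M, for the pairs
-- (σ , τ), and N further vertices, for a simplex x of Int.
module Coordinates (n N : ℕ) where

  G : ℕ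
  G = n + (n + N)

  ι₁ ι₂ : Fin n → Fin G
  ι₁ v = v ↑ˡ (n + N)
  ι₂ v = n ↑ʳ (v ↑ˡ N)

  ι₃ : Fin N → Fin G
  ι₃ i = n ↑ʳ (n ↑ʳ i)

  left≢right : ∀ {m l} (v : Fin m) (w : Fin l) → v ↑ˡ l ≢ m ↑ʳ w
  left≢right {m} {l} v w eq with trans (sym (Fin.splitAt-↑ˡ m v l)) (trans (cong (splitAt m) eq) (Fin.splitAt-↑ʳ m l w))
  ... | ()

  ι₁-injective : ∀ {u v} → ι₁ u ≡ ι₁ v → u ≡ v
  ι₁-injective = Fin.↑ˡ-injective (n + N) _ _

  ι₂-injective : ∀ {u v} → ι₂ u ≡ ι₂ v → u ≡ v
  ι₂-injective = Fin.↑ˡ-injective N _ _ ∘ Fin.↑ʳ-injective n _ _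

  ι₃-injective : ∀ {u v} → ι₃ u ≡ ι₃ v → u ≡ v
  ι₃-injective = Fin.↑ʳ-injective n _ _ ∘ Fin.↑ʳ-injective n _ _

  ι₁≢ι₂ : ∀ u v → ι₁ u ≢ ι₂ v
  ι₁≢ι₂ u v = left≢right u (v ↑ˡ N)

  ι₁≢ι₃ : ∀ u i → ι₁ u ≢ ι₃ i
  ι₁≢ι₃ u i = left≢right u (n ↑ʳ i)

  ι₂≢ι₃ : ∀ u i → ι₂ u ≢ ι₃ i
  ι₂≢ι₃ u i = left≢right u i ∘ Fin.↑ʳ-injective n _ _

  data Coordinate : Fin G → Set where
    in₁ : ∀ v → Coordinate (ι₁ v)
    in₂ : ∀ v → Coordinate (ι₂ v)
    in₃ : ∀ i → Coordinate (ι₃ i)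

  coordinate : ∀ j → Coordinate j
  coordinate j with splitAt n j in eq
  ... | inj₁ v = subst Coordinate (Fin.splitAt⁻¹-↑ˡ eq) (in₁ v)
  ... | inj₂ w with splitAt n w in eq′
  ...   | inj₁ v = subst Coordinate (trans (cong (n ↑ʳ_) (Fin.splitAt⁻¹-↑ˡ eq′)) (Fin.splitAt⁻¹-↑ʳ eq)) (in₂ v)
  ...   | inj₂ i = subst Coordinate (trans (cong (n ↑ʳ_) (Fin.splitAt⁻¹-↑ʳ eq′)) (Fin.splitAt⁻¹-↑ʳ eq)) (in₃ i)

  θ₁ : Thinning n G
  θ₁ = leftᵗ n (n + N)

  θ₃ : Thinning N G
  θ₃ = rightᵗ n (rightᵗ n (allᵗ N))

  embed-θ₁ : ∀ v → embed θ₁ v ≡ ι₁ v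
  embed-θ₁ = embed-left (n + N)

  embed-θ₃ : ∀ i → embed θ₃ i ≡ ι₃ i
  embed-θ₃ i = trans (embed-right n (rightᵗ n (allᵗ N)) i)
    (cong (n ↑ʳ_) (trans (embed-right n (allᵗ N) i) (cong (n ↑ʳ_) (embed-all i))))

  pr₁ pr₂ : Subset G → Subset n
  pr₁ = preimage ι₁
  pr₂ = preimage ι₂

  pr₃ : Subset G → Subset N
  pr₃ = preimage ι₃

  -- A down-closed condition on triples. Since `down` carries it along inclusions, projections of
  -- unions and images are compared by inclusions rather than equations.
  record Family : Set₁ where
    field
      Holds  : Subset n → Subset n → Subset N → Set
      holds? : ∀ σ τ x → Dec (Holds σ τ x)
      empty  : Holds ⊥ ⊥ ⊥
      down   : ∀ {σ σ′ τ τ′ x x′} → σ ⊆ σ′ → τ ⊆ τ′ → x ⊆ x′ → Holds σ′ τ′ x′ → Holds σ τ x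

  open Family public

  ⟦_⟧ : Family → Complex G
  ⟦ F ⟧ .Face S = Holds F (pr₁ S) (pr₂ S) (pr₃ S)
  ⟦ F ⟧ .face? S = holds? F (pr₁ S) (pr₂ S) (pr₃ S)
  ⟦ F ⟧ .∅-face = down F (preimage-⊥ ι₁) (preimage-⊥ ι₂) (preimage-⊥ ι₃) (empty F)
  ⟦ F ⟧ .down-closed S⊆T = down F (preimage-mono ι₁ S⊆T) (preimage-mono ι₂ S⊆T) (preimage-mono ι₃ S⊆T)

  cone₁ : ∀ F v → (∀ {σ τ x} → Holds F σ τ x → Holds F (σ ∪ ⁅ v ⁆) τ x) → ∀ t → Acyclic ⟦ F ⟧ t
  cone₁ F v closed = cone-acyclic ⟦ F ⟧ (ι₁ v) λ {S} h → down F
    (preimage-∪⁅⁆ ι₁ ι₁-injective S v)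
    (preimage-∪⁅⁆-disjoint ι₂ (λ u eq → ι₁≢ι₂ v u (sym eq)) S)
    (preimage-∪⁅⁆-disjoint ι₃ (λ u eq → ι₁≢ι₃ v u (sym eq)) S) (closed h)

  cone₂ : ∀ F v → (∀ {σ τ x} → Holds F σ τ x → Holds F σ (τ ∪ ⁅ v ⁆) x) → ∀ t → Acyclic ⟦ F ⟧ t
  cone₂ F v closed = cone-acyclic ⟦ F ⟧ (ι₂ v) λ {S} h → down F
    (preimage-∪⁅⁆-disjoint ι₁ (λ u → ι₁≢ι₂ u v) S)
    (preimage-∪⁅⁆ ι₂ ι₂-injective S v)
    (preimage-∪⁅⁆-disjoint ι₃ (λ u eq → ι₂≢ι₃ v u (sym eq)) S) (closed h)

  acyclic-⟦⟧ : ∀ F F′ → (∀ {σ τ x} → Holds F σ τ x → Holds F′ σ τ x) →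
    (∀ {σ τ x} → Holds F′ σ τ x → Holds F σ τ x) → ∀ {t} → Acyclic ⟦ F ⟧ t → Acyclic ⟦ F′ ⟧ t
  acyclic-⟦⟧ F F′ to from = acyclic-resp {K = ⟦ F ⟧} {⟦ F′ ⟧} to from

  -- This carries the connectivity of `C` to the join at the start of the induction in
  -- `join-acyclic`; `image₃` leads back to the third coordinate at the end of `desuspend`.
  image₁ : ∀ (K : Complex n) F → (∀ {σ} → Face K σ → Holds F σ ⊥ ⊥) → (∀ {σ} → Holds F σ ⊥ ⊥ → Face K σ) →
    (∀ {σ τ x} → Holds F σ τ x → τ ⊆ ⊥ × x ⊆ ⊥) → Image θ₁ K ⟦ F ⟧
  image₁ K F to from empty = record
    { to   = λ {σ} f → down F (preimage-image θ₁ ι₁ embed-θ₁ ι₁-injective σ)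
               (preimage-image-disjoint θ₁ ι₂ (λ v w eq → ι₁≢ι₂ w v (sym (trans eq (embed-θ₁ w)))) σ)
               (preimage-image-disjoint θ₁ ι₃ (λ i w eq → ι₁≢ι₃ w i (sym (trans eq (embed-θ₁ w)))) σ) (to f)
    ; from = λ {σ} h → from (down F (⊆-preimage-image θ₁ ι₁ embed-θ₁ σ) (⊆-min _) (⊆-min _) h)
    ; onto = λ {ρ} h → pr₁ ρ , image-preimage θ₁ ι₁ embed-θ₁ ρ (range ρ (empty h))
    }
    where
    range : ∀ ρ → pr₂ ρ ⊆ ⊥ × pr₃ ρ ⊆ ⊥ → ∀ {j} → j ∈ ρ → ∃ λ v → j ≡ ι₁ v
    range ρ (e₂ , e₃) {j} j∈ρ with coordinate j
    ... | in₁ v = v , refl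
    ... | in₂ v = contradiction (e₂ (∈-preimage⁺ ι₂ j∈ρ)) ∉⊥
    ... | in₃ i = contradiction (e₃ (∈-preimage⁺ ι₃ j∈ρ)) ∉⊥

  image₃ : ∀ (K : Complex N) F → (∀ {x} → Face K x → Holds F ⊥ ⊥ x) → (∀ {x} → Holds F ⊥ ⊥ x → Face K x) →
    (∀ {σ τ x} → Holds F σ τ x → σ ⊆ ⊥ × τ ⊆ ⊥) → Image θ₃ K ⟦ F ⟧
  image₃ K F to from empty = record
    { to   = λ {x} f → down F
               (preimage-image-disjoint θ₃ ι₁ (λ v w eq → ι₁≢ι₃ v w (trans eq (embed-θ₃ w))) x)
               (preimage-image-disjoint θ₃ ι₂ (λ v w eq → ι₂≢ι₃ v w (trans eq (embed-θ₃ w))) x)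
               (preimage-image θ₃ ι₃ embed-θ₃ ι₃-injective x) (to f)
    ; from = λ {x} h → from (down F (⊆-min _) (⊆-min _) (⊆-preimage-image θ₃ ι₃ embed-θ₃ x) h)
    ; onto = λ {ρ} h → pr₃ ρ , image-preimage θ₃ ι₃ embed-θ₃ ρ (range ρ (empty h))
    }
    where
    range : ∀ ρ → pr₁ ρ ⊆ ⊥ × pr₂ ρ ⊆ ⊥ → ∀ {j} → j ∈ ρ → ∃ λ i → j ≡ ι₃ i
    range ρ (e₁ , e₂) {j} j∈ρ with coordinate j
    ... | in₁ v = contradiction (e₁ (∈-preimage⁺ ι₁ j∈ρ)) ∉⊥
    ... | in₂ v = contradiction (e₂ (∈-preimage⁺ ι₂ j∈ρ)) ∉⊥
    ... | in₃ i = i , refl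

-- Joins with the dual matroid, and their coverings

Uncovered : ∀ {n} → Subset n → Subset n → List (Fin n) → Set
Uncovered σ τ = Any (λ v → v ∉ σ × v ∉ τ)

uncovered? : ∀ {n} (σ τ : Subset n) vs → Dec (Uncovered σ τ vs)
uncovered? σ τ = Any.any? (λ v → ¬? (v ∈? σ) ×-dec ¬? (v ∈? τ))

uncovered-down : ∀ {n} {σ σ′ τ τ′ : Subset n} {vs} → σ ⊆ σ′ → τ ⊆ τ′ → Uncovered σ′ τ′ vs → Uncovered σ τ vs
uncovered-down σ⊆ τ⊆ = Any.map (λ (v∉σ , v∉τ) → v∉σ ∘ σ⊆ , v∉τ ∘ τ⊆)

∁∪⊆ : ∀ {n} (p : Subset n) v → ∁ p ⊆ ∁ (p ∪ ⁅ v ⁆) ∪ ⁅ v ⁆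
∁∪⊆ p v {x} x∈∁p with x Fin.≟ v
... | yes refl = y∈∪⁅y⁆ _ v
... | no  x≢v  = p⊆p∪q ⁅ v ⁆ (x∉p⇒x∈∁p λ x∈ → [ x∈∁p⇒x∉p x∈∁p , x≢v ]′ (∈∪⁅⁆⁻ p x∈))

∩-mono : ∀ {n} {p p′ q q′ : Subset n} → p ⊆ p′ → q ⊆ q′ → p ∩ q ⊆ p′ ∩ q′
∩-mono {p = p} {q = q} p⊆ q⊆ x∈ = let x∈p , x∈q = x∈p∩q⁻ p q x∈ in x∈p∩q⁺ (p⊆ x∈p , q⊆ x∈q)

∁-anti : ∀ {n} {p q : Subset n} → p ⊆ q → ∁ q ⊆ ∁ p
∁-anti p⊆q x∈ = x∉p⇒x∈∁p (x∈∁p⇒x∉p x∈ ∘ p⊆q)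

-- The τ ⊆ W such that Y ─ τ has rank at least k are the independent sets of a
-- matroid, a minor of the dual of the truncation of M. The connectivity of its
-- join with C is bounded by deleting and contracting an element v of W; if v
-- lies in the closure of Y ─ W, then v is a coloop and the join is a cone.
module JoinMatroid {n : ℕ} (N : ℕ) (M : Matroid n) (k : ℕ) (C : Complex n) where
  open Coordinates n N
  open Rank M

  -- Deleting `v` from the matroid takes it out of `W`; contracting `v` takes it out of both `W` and
  -- `Y`. The proof of `k ≤ r Y` makes the empty set independent.
  J : ∀ W Y → k ≤ r Y → Family
  J W Y k≤rY .Holds σ τ x = Face C σ × τ ⊆ W × k ≤ r (Y ∩ ∁ τ) × x ⊆ ⊥
  J W Y k≤rY .holds? σ τ x = face? C σ ×-dec (τ ⊆? W) ×-dec (k ≤? r (Y ∩ ∁ τ)) ×-dec (x ⊆? ⊥)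
  J W Y k≤rY .empty = ∅-face C , ⊆-min W , ℕ.≤-trans k≤rY (r-mono λ y∈ → x∈p∩q⁺ (y∈ , x∉p⇒x∈∁p ∉⊥)) , id
  J W Y k≤rY .down σ⊆ τ⊆ x⊆ (f , τ⊆W , k≤r , x⊆⊥) = down-closed C σ⊆ f , ⊆-trans τ⊆ τ⊆W ,
    ℕ.≤-trans k≤r (r-mono (∩-mono id (∁-anti τ⊆))) , ⊆-trans x⊆ x⊆⊥

  -- The matroid has rank `∣ W ∣ - k + r (Y ∩ ∁ W)`, so the claim is that joining with its complex
  -- raises the connectivity of `C` by at least this rank.
  join-acyclic : ∀ {t} → Acyclic C t → ∀ p {W Y} → ∣ W ∣ ≡ p → W ⊆ Y → (k≤rY : k ≤ r Y) → r (Y ∩ ∁ W) ≤ k →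
    ∀ s → s + k ≤ t + p + r (Y ∩ ∁ W) → Acyclic ⟦ J W Y k≤rY ⟧ s
  join-acyclic {t} H zero {W} {Y} ∣W∣≡0 W⊆Y k≤rY rZ≤k s s+k≤ = image-acyclic
    (image₁ C (J W Y k≤rY)
      (λ f → f , ⊆-min W , proj₁ (proj₂ (proj₂ (empty (J W Y k≤rY)))) , id)
      proj₁
      (λ (_ , τ⊆W , _ , x⊆⊥) → (λ v∈τ → contradiction (τ⊆W v∈τ) (W-empty _)) , x⊆⊥))
    (acyclic-≤ {K = C} s≤t H)
    where
    s≤t : s ≤ t
    s≤t = ℕ.+-cancelʳ-≤ k s t (ℕ.≤-trans s+k≤ (subst (λ u → u + r (Y ∩ ∁ W) ≤ t + k) (sym (ℕ.+-identityʳ t)) (ℕ.+-monoʳ-≤ t rZ≤k)))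
    W-empty : ∀ v → v ∉ W
    W-empty v v∈W = contradiction (trans (sym ∣W∣≡0) (∣p∣≡1+∣p-x∣ W v∈W)) λ ()
  join-acyclic H (suc p) ∣W∣≡1+p W⊆Y k≤rY rZ≤k zero _ = λ _ ()
  join-acyclic {t} H (suc p) {W} {Y} ∣W∣≡1+p W⊆Y k≤rY rZ≤k (suc s) s+k≤ = pick (nonempty? W)
    where
    Z : Subset n
    Z = Y ∩ ∁ W
    pick : Dec (Nonempty W) → Acyclic ⟦ J W Y k≤rY ⟧ (suc s)
    pick (no W≡∅) = contradiction (trans (sym ∣W∣≡1+p) (trans (cong ∣_∣ (Empty-unique W≡∅)) (∣⊥∣≡0 n))) λ ()
    pick (yes (v , v∈W)) = cases (r (Z ∪ ⁅ v ⁆) ≤? r Z) (k ≤? r Z)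
      where
      Z⊆ : ∀ {τ} → τ ⊆ W → Z ⊆ Y ∩ ∁ (τ ∪ ⁅ v ⁆)
      Z⊆ τ⊆W = ∩-mono id (∁-anti (∪-least τ⊆W (⁅⁆⊆ v∈W)))
      Y∩∁⊆ : ∀ τ → Y ∩ ∁ τ ⊆ (Y ∩ ∁ (τ ∪ ⁅ v ⁆)) ∪ ⁅ v ⁆
      Y∩∁⊆ τ x∈ with x∈p∩q⁻ Y (∁ τ) x∈
      ... | x∈Y , x∈∁τ with ∈∪⁅⁆⁻ (∁ (τ ∪ ⁅ v ⁆)) (∁∪⊆ τ v x∈∁τ)
      ...   | inj₁ x∈   = p⊆p∪q ⁅ v ⁆ (x∈p∩q⁺ (x∈Y , x∈))
      ...   | inj₂ refl = y∈∪⁅y⁆ _ v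
      size : ∣ W - v ∣ ≡ p
      size = ℕ.suc-injective (trans (sym (∣p∣≡1+∣p-x∣ W v∈W)) ∣W∣≡1+p)
      cases : Dec (r (Z ∪ ⁅ v ⁆) ≤ r Z) → Dec (k ≤ r Z) → Acyclic ⟦ J W Y k≤rY ⟧ (suc s)
      cases (yes v∈cl) _ = cone₂ (J W Y k≤rY) v
        (λ {σ} {τ} (f , τ⊆W , k≤r , x⊆⊥) → f , ∪-least τ⊆W (⁅⁆⊆ v∈W) ,
          ℕ.≤-trans k≤r (ℕ.≤-trans (r-mono (Y∩∁⊆ τ)) (r-closure v (Z⊆ τ⊆W) v∈cl)) , x⊆⊥) (suc s)
      -- Every subset of `W` is independent here, so `v` is again an apex.
      cases (no _) (yes k≤rZ) = cone₂ (J W Y k≤rY) v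
        (λ (f , τ⊆W , k≤r , x⊆⊥) → f , ∪-least τ⊆W (⁅⁆⊆ v∈W) , ℕ.≤-trans k≤rZ (r-mono (Z⊆ τ⊆W)) , x⊆⊥) (suc s)
      cases (no v∉cl) (no k≰rZ) = attach (k ≤? r (Y - v))
        where
        rZ′≡ : r (Y ∩ ∁ (W - v)) ≡ suc (r Z)
        rZ′≡ = ℕ.≤-antisym (ℕ.≤-trans (r-mono Z′⊆) (r-∪⁅⁆ Z v)) (ℕ.≤-trans (ℕ.≰⇒> v∉cl) (r-mono ⊆Z′))
          where
          Z′⊆ : Y ∩ ∁ (W - v) ⊆ Z ∪ ⁅ v ⁆
          Z′⊆ {x} x∈ with x∈p∩q⁻ Y (∁ (W - v)) x∈ | x Fin.≟ v
          ... | _ | yes refl = y∈∪⁅y⁆ Z v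
          ... | x∈Y , x∉ | no x≢v = p⊆p∪q ⁅ v ⁆ (x∈p∩q⁺ (x∈Y , x∉p⇒x∈∁p λ x∈W → x∈∁p⇒x∉p x∉ (x∈p∧x≢y⇒x∈p-y x∈W x≢v)))
          ⊆Z′ : Z ∪ ⁅ v ⁆ ⊆ Y ∩ ∁ (W - v)
          ⊆Z′ = ∪-least (∩-mono id (∁-anti (x∈p-y⇒x∈p W))) (⁅⁆⊆ (x∈p∩q⁺ (W⊆Y v∈W , x∉p⇒x∈∁p (λ v∈ → x∈p-y⇒x≢y W v∈ refl))))
        -- Taking `v` out of `W` raises `r (Y ∩ ∁ W)` by one, so the rank of the matroid, and with
        -- it the bound, is unchanged.
        deleted : Acyclic ⟦ J (W - v) Y k≤rY ⟧ (suc s)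
        deleted = join-acyclic H p size (W⊆Y ∘ x∈p-y⇒x∈p W) k≤rY (subst (_≤ k) (sym rZ′≡) (ℕ.≰⇒> k≰rZ)) (suc s)
          (ℕ.≤-trans s+k≤ (ℕ.≤-reflexive (trans (cong (_+ r Z) (ℕ.+-suc t p))
            (trans (sym (ℕ.+-suc (t + p) (r Z))) (cong (t + p +_) (sym rZ′≡))))))
        attach : Dec (k ≤ r (Y - v)) → Acyclic ⟦ J W Y k≤rY ⟧ (suc s)
        -- Here `v` is a loop: no independent set contains it.
        attach (no k≰) = acyclic-⟦⟧ (J (W - v) Y k≤rY) (J W Y k≤rY)
          (λ (f , τ⊆ , rest) → f , x∈p-y⇒x∈p W ∘ τ⊆ , rest)
          (λ (f , τ⊆ , k≤r , x⊆⊥) → f , (λ u∈τ → x∈p∧x≢y⇒x∈p-y (τ⊆ u∈τ) λ { refl →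
             k≰ (ℕ.≤-trans k≤r (r-mono λ y∈ → let y∈Y , y∉τ = x∈p∩q⁻ Y _ y∈ in
               x∈p∧x≢y⇒x∈p-y y∈Y λ { refl → x∈∁p⇒x∉p y∉τ u∈τ })) }) , k≤r , x⊆⊥)
          deleted
        -- The star of `v` is a cone, attached to the deletion along the contraction. There `W`
        -- loses a point while `r (Y ∩ ∁ W)` stays the same, so the bound drops by one, as `union`
        -- allows.
        attach (yes k≤) = MayerVietoris.union
          {K = ⟦ J W Y k≤rY ⟧} {⟦ J (W - v) Y k≤rY ⟧} {⟦ J W (Y - v) k≤ ⟧} {⟦ J (W - v) (Y - v) k≤ ⟧}
          (record
            { A⊆K   = λ (f , τ⊆ , rest) → f , x∈p-y⇒x∈p W ∘ τ⊆ , rest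
            ; B⊆K   = λ (f , τ⊆ , k≤r , x⊆⊥) → f , τ⊆ , ℕ.≤-trans k≤r (r-mono (∩-mono (x∈p-y⇒x∈p Y) id)) , x⊆⊥
            ; K⊆A∪B = λ {S} → split {S}
            ; I⊆A   = λ (f , τ⊆ , k≤r , x⊆⊥) → f , τ⊆ , ℕ.≤-trans k≤r (r-mono (∩-mono (x∈p-y⇒x∈p Y) id)) , x⊆⊥
            ; I⊆B   = λ (f , τ⊆ , rest) → f , x∈p-y⇒x∈p W ∘ τ⊆ , rest
            ; A∩B⊆I = λ (f , τ⊆ , _) (_ , _ , rest) → f , τ⊆ , rest
            })
          deleted
          (cone₂ (J W (Y - v) k≤) v (λ (f , τ⊆ , k≤r , x⊆⊥) → f , ∪-least τ⊆ (⁅⁆⊆ v∈W) , ℕ.≤-trans k≤r (r-mono star) , x⊆⊥) (suc s))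
          (join-acyclic H p size W-v⊆Y-v k≤ (ℕ.≤-trans (r-mono Z″⊆) rZ≤k) s
            (ℕ.≤-trans (s≤s⁻¹ (ℕ.≤-trans s+k≤ (ℕ.≤-reflexive (cong (_+ r Z) (ℕ.+-suc t p)))))
              (ℕ.+-monoʳ-≤ (t + p) (r-mono ⊆Z″))))
          where
          W-v⊆Y-v : W - v ⊆ Y - v
          W-v⊆Y-v x∈ = x∈p∧x≢y⇒x∈p-y (W⊆Y (x∈p-y⇒x∈p W x∈)) (x∈p-y⇒x≢y W x∈)
          star : ∀ {τ} → (Y - v) ∩ ∁ τ ⊆ (Y - v) ∩ ∁ (τ ∪ ⁅ v ⁆)
          star {τ} x∈ = let x∈Y-v , x∉τ = x∈p∩q⁻ (Y - v) (∁ τ) x∈ in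
            x∈p∩q⁺ (x∈Y-v , x∉p⇒x∈∁p λ x∈τv → [ x∈∁p⇒x∉p x∉τ , x∈p-y⇒x≢y Y x∈Y-v ]′ (∈∪⁅⁆⁻ τ x∈τv))
          Z″⊆ : (Y - v) ∩ ∁ (W - v) ⊆ Z
          Z″⊆ x∈ = let x∈Y-v , x∉ = x∈p∩q⁻ (Y - v) (∁ (W - v)) x∈ in
            x∈p∩q⁺ (x∈p-y⇒x∈p Y x∈Y-v , x∉p⇒x∈∁p λ x∈W → x∈∁p⇒x∉p x∉ (x∈p∧x≢y⇒x∈p-y x∈W (x∈p-y⇒x≢y Y x∈Y-v)))
          ⊆Z″ : Z ⊆ (Y - v) ∩ ∁ (W - v)
          ⊆Z″ x∈ = let x∈Y , x∉W = x∈p∩q⁻ Y (∁ W) x∈ in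
            x∈p∩q⁺ (x∈p∧x≢y⇒x∈p-y x∈Y (λ { refl → x∈∁p⇒x∉p x∉W v∈W }) , ∁-anti (x∈p-y⇒x∈p W) x∉W)
          split : ∀ {S} → Face ⟦ J W Y k≤rY ⟧ S → Face ⟦ J (W - v) Y k≤rY ⟧ S ⊎ Face ⟦ J W (Y - v) k≤ ⟧ S
          split {S} (f , τ⊆ , k≤r , x⊆⊥) with v ∈? pr₂ S
          ... | yes v∈τ = inj₂ (f , τ⊆ , ℕ.≤-trans k≤r (r-mono λ y∈ → let y∈Y , y∉τ = x∈p∩q⁻ Y _ y∈ in
                  x∈p∩q⁺ (x∈p∧x≢y⇒x∈p-y y∈Y (λ { refl → x∈∁p⇒x∉p y∉τ v∈τ }) , y∉τ)) , x⊆⊥)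
          ... | no v∉τ  = inj₁ (f , (λ u∈τ → x∈p∧x≢y⇒x∈p-y (τ⊆ u∈τ) λ { refl → v∉τ u∈τ }) , k≤r , x⊆⊥)

-- The bound of the theorem on the connectivity of `C ↾ I`, in terms of `Acyclic`. Quantifying over
-- `s` avoids subtraction and covers infinite values.
Connected : ∀ {n} → Matroid n → ℕ → ℕ → Complex n → Set
Connected M k m C = ∀ I → IsFlat M (∁ I) → rank (M ↾ᴹ ∁ I) < k →
  ∀ s → s + rank (M ↾ᴹ ∁ I) ≤ k + m → Acyclic (C ↾ I) s

module Covering {n : ℕ} (N : ℕ) (M : Matroid n) (k : ℕ) (k≤r⊤ : k ≤ Rank.r M ⊤)
  (C : Complex n) (m : ℕ) (connected : Connected M k m C) where
  open Coordinates n N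
  open Rank M

  full : Subset n → Family
  full I .Holds σ τ x = σ ⊆ I × τ ⊆ I × x ⊆ ⊥
  full I .holds? σ τ x = (σ ⊆? I) ×-dec (τ ⊆? I) ×-dec (x ⊆? ⊥)
  full I .empty = ⊆-min I , ⊆-min I , id
  full I .down σ⊆ τ⊆ x⊆ (σ⊆I , τ⊆I , x⊆⊥) = ⊆-trans σ⊆ σ⊆I , ⊆-trans τ⊆ τ⊆I , ⊆-trans x⊆ x⊆⊥

  full-acyclic : ∀ {I} → Nonempty I → ∀ t → Acyclic ⟦ full I ⟧ t
  full-acyclic {I} (v , v∈I) = cone₁ (full I) v (λ (σ⊆I , rest) → ∪-least σ⊆I (⁅⁆⊆ v∈I) , rest)

  spanning-∅ : k ≤ r (∁ ⊥)
  spanning-∅ = ℕ.≤-trans k≤r⊤ (r-mono λ _ → x∉p⇒x∈∁p ∉⊥)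

  -- For vs = [] this is the join of C[I] with the restriction to I of the dual
  -- of the truncation of M.
  Cov : Subset n → List (Fin n) → Family
  Cov I vs .Holds σ τ x = Holds (full I) σ τ x × ((Face C σ × k ≤ r (∁ τ)) ⊎ Uncovered σ τ vs)
  Cov I vs .holds? σ τ x = holds? (full I) σ τ x ×-dec ((face? C σ ×-dec (k ≤? r (∁ τ))) ⊎-dec uncovered? σ τ vs)
  Cov I vs .empty = empty (full I) , inj₁ (∅-face C , spanning-∅)
  Cov I vs .down σ⊆ τ⊆ x⊆ (f , inj₁ (σ∈C , k≤r)) =
    down (full I) σ⊆ τ⊆ x⊆ f , inj₁ (down-closed C σ⊆ σ∈C , ℕ.≤-trans k≤r (r-mono (∁-anti τ⊆)))
  Cov I vs .down σ⊆ τ⊆ x⊆ (f , inj₂ u) = down (full I) σ⊆ τ⊆ x⊆ f , inj₂ (uncovered-down σ⊆ τ⊆ u)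

  -- If `∁ I` has rank at least `k`, or its closure contains a point of `I`, the complex is a cone.
  -- Otherwise `∁ I` is a flat of rank below `k`, and `connected` gives the bound `k + m - r (∁ I)`
  -- for `C ↾ I`; adding the matroid rank `∣ I ∣ - k + r (∁ I)` yields `∣ I ∣ + m`.
  Cov[]-acyclic : ∀ {I} → Nonempty I → Acyclic ⟦ Cov I [] ⟧ (∣ I ∣ + m)
  Cov[]-acyclic {I} (v₀ , v₀∈I) = cases (k ≤? r (∁ I)) (Fin.any? (λ v → (v ∈? I) ×-dec (r (∁ I ∪ ⁅ v ⁆) ≤? r (∁ I))))
    where
    ∁I⊆ : ∀ {v τ} → v ∈ I → τ ⊆ I → ∁ I ⊆ ∁ (τ ∪ ⁅ v ⁆)
    ∁I⊆ v∈I τ⊆I = ∁-anti (∪-least τ⊆I (⁅⁆⊆ v∈I))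
    cases : Dec (k ≤ r (∁ I)) → Dec (∃ λ v → v ∈ I × r (∁ I ∪ ⁅ v ⁆) ≤ r (∁ I)) → Acyclic ⟦ Cov I [] ⟧ (∣ I ∣ + m)
    cases (yes k≤) _ = cone₂ (Cov I []) v₀ (λ { ((σ⊆I , τ⊆I , x⊆⊥) , inj₁ (σ∈C , _)) →
      (σ⊆I , ∪-least τ⊆I (⁅⁆⊆ v₀∈I) , x⊆⊥) , inj₁ (σ∈C , ℕ.≤-trans k≤ (r-mono (∁I⊆ v₀∈I τ⊆I))) }) _
    cases (no _) (yes (v , v∈I , v∈cl)) = cone₂ (Cov I []) v (λ { {τ = τ} ((σ⊆I , τ⊆I , x⊆⊥) , inj₁ (σ∈C , k≤r)) →
      (σ⊆I , ∪-least τ⊆I (⁅⁆⊆ v∈I) , x⊆⊥) ,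
      inj₁ (σ∈C , ℕ.≤-trans k≤r (ℕ.≤-trans (r-mono (∁∪⊆ τ v)) (r-closure v (∁I⊆ v∈I τ⊆I) v∈cl))) }) _
    cases (no k≰) (no none) = acyclic-⟦⟧ (J I ⊤ k≤r⊤) (Cov I [])
      (λ ((σ∈C , σ⊆I) , τ⊆I , k≤r , x⊆⊥) → (σ⊆I , τ⊆I , x⊆⊥) , inj₁ (σ∈C , ℕ.≤-trans k≤r (r-mono (p∩q⊆q ⊤ _))))
      (λ { ((σ⊆I , τ⊆I , x⊆⊥) , inj₁ (σ∈C , k≤r)) →
           (σ∈C , σ⊆I) , τ⊆I , ℕ.≤-trans k≤r (r-mono λ x∈ → x∈p∩q⁺ (∈⊤ , x∈)) , x⊆⊥ })
      (join-acyclic (connected I flat (ℕ.≰⇒> k≰) t (ℕ.≤-reflexive t+r≡k+m)) ∣ I ∣ refl (⊆-max I) k≤r⊤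
        (ℕ.≤-trans (r-mono (p∩q⊆q ⊤ (∁ I))) (ℕ.<⇒≤ (ℕ.≰⇒> k≰))) (∣ I ∣ + m) bound)
      where
      open JoinMatroid N M k (C ↾ I)
      flat : IsFlat M (∁ I)
      flat x x∉∁I = ℕ.≰⇒> λ le → none (x , x∉∁p⇒x∈p x∉∁I , le)
      t : ℕ
      t = k + m ∸ r (∁ I)
      t+r≡k+m : t + r (∁ I) ≡ k + m
      t+r≡k+m = ℕ.m∸n+n≡m (ℕ.≤-trans (ℕ.<⇒≤ (ℕ.≰⇒> k≰)) (ℕ.m≤m+n k m))
      bound : ∣ I ∣ + m + k ≤ t + ∣ I ∣ + r (⊤ ∩ ∁ I)
      bound = begin
        ∣ I ∣ + m + k             ≡⟨ ℕ.+-assoc ∣ I ∣ m k ⟩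
        ∣ I ∣ + (m + k)           ≡⟨ cong (∣ I ∣ +_) (ℕ.+-comm m k) ⟩
        ∣ I ∣ + (k + m)           ≡⟨ cong (∣ I ∣ +_) t+r≡k+m ⟨
        ∣ I ∣ + (t + r (∁ I))     ≡⟨ ℕ.+-assoc ∣ I ∣ t (r (∁ I)) ⟨
        ∣ I ∣ + t + r (∁ I)       ≡⟨ cong₂ _+_ (ℕ.+-comm ∣ I ∣ t) (cong r (sym (∩-identityˡ (∁ I)))) ⟩
        t + ∣ I ∣ + r (⊤ ∩ ∁ I)   ∎
        where open ℕ.≤-Reasoning

  -- Admitting v as an uncovered element glues in a full simplex on I - v.
  Cov-acyclic : ∀ vs {I} → Nonempty I → Acyclic ⟦ Cov I vs ⟧ (∣ I ∣ + m)
  Cov-acyclic []       ne = Cov[]-acyclic ne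
  Cov-acyclic (v ∷ vs) {I} ne = cases (v ∈? I) (nonempty? (I - v))
    where
    missing : ∀ {ρ} → v ∉ I → ρ ⊆ I → v ∉ ρ
    missing v∉I ρ⊆I = v∉I ∘ ρ⊆I
    avoids : ∀ {ρ} → ρ ⊆ I → v ∉ ρ → ρ ⊆ I - v
    avoids ρ⊆I v∉ρ u∈ρ = x∈p∧x≢y⇒x∈p-y (ρ⊆I u∈ρ) λ { refl → v∉ρ u∈ρ }
    v∉I-v : v ∉ I - v
    v∉I-v v∈ = x∈p-y⇒x≢y I v∈ refl
    weaken : ∀ {σ τ} → (Face C σ × k ≤ r (∁ τ)) ⊎ Uncovered σ τ vs → (Face C σ × k ≤ r (∁ τ)) ⊎ Uncovered σ τ (v ∷ vs)
    weaken (inj₁ h) = inj₁ h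
    weaken (inj₂ u) = inj₂ (there u)
    cases : Dec (v ∈ I) → Dec (Nonempty (I - v)) → Acyclic ⟦ Cov I (v ∷ vs) ⟧ (∣ I ∣ + m)
    -- Every pair leaves `v` uncovered, so nothing but the full simplex remains.
    cases (no v∉I) _ = acyclic-⟦⟧ (full I) (Cov I (v ∷ vs))
      (λ (σ⊆I , τ⊆I , x⊆⊥) → (σ⊆I , τ⊆I , x⊆⊥) , inj₂ (here (missing v∉I σ⊆I , missing v∉I τ⊆I))) proj₁
      (full-acyclic ne _)
    -- With `I` reduced to `v`, the simplex to be glued in is the empty face alone, which is already
    -- present.
    cases (yes v∈I) (no I-v≡∅) = acyclic-⟦⟧ (Cov I vs) (Cov I (v ∷ vs))
      (λ (f , h) → f , weaken h)
      (λ { (f , inj₁ h) → f , inj₁ h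
         ; (f , inj₂ (there u)) → f , inj₂ u
         ; ((σ⊆I , τ⊆I , x⊆⊥) , inj₂ (here (v∉σ , v∉τ))) → (σ⊆I , τ⊆I , x⊆⊥) ,
             inj₁ (down-closed C (λ u∈ → contradiction (_ , avoids σ⊆I v∉σ u∈) I-v≡∅) (∅-face C) ,
                   ℕ.≤-trans k≤r⊤ (r-mono λ _ → x∉p⇒x∈∁p λ u∈ → I-v≡∅ (_ , avoids τ⊆I v∉τ u∈))) })
      (Cov-acyclic vs ne)
    -- The pieces meet in the same complex over `I - v`; the lost point costs one degree, as `union`
    -- allows.
    cases (yes v∈I) (yes ne′) = subst (λ e → Acyclic ⟦ Cov I (v ∷ vs) ⟧ (e + m)) (sym (∣p∣≡1+∣p-x∣ I v∈I))
      (MayerVietoris.union {K = ⟦ Cov I (v ∷ vs) ⟧} {⟦ Cov I vs ⟧} {⟦ full (I - v) ⟧} {⟦ Cov (I - v) vs ⟧}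
        (record
          { A⊆K   = λ (f , h) → f , weaken h
          ; B⊆K   = λ (σ⊆ , τ⊆ , x⊆⊥) → (x∈p-y⇒x∈p I ∘ σ⊆ , x∈p-y⇒x∈p I ∘ τ⊆ , x⊆⊥) , inj₂ (here (v∉I-v ∘ σ⊆ , v∉I-v ∘ τ⊆))
          ; K⊆A∪B = λ { (f , inj₁ h) → inj₁ (f , inj₁ h)
                      ; (f , inj₂ (there u)) → inj₁ (f , inj₂ u)
                      ; ((σ⊆I , τ⊆I , x⊆⊥) , inj₂ (here (v∉σ , v∉τ))) → inj₂ (avoids σ⊆I v∉σ , avoids τ⊆I v∉τ , x⊆⊥) }
          ; I⊆A   = λ ((σ⊆ , τ⊆ , x⊆⊥) , h) → (x∈p-y⇒x∈p I ∘ σ⊆ , x∈p-y⇒x∈p I ∘ τ⊆ , x⊆⊥) , h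
          ; I⊆B   = proj₁
          ; A∩B⊆I = λ (_ , h) f → f , h
          })
        (subst (λ e → Acyclic ⟦ Cov I vs ⟧ (e + m)) (∣p∣≡1+∣p-x∣ I v∈I) (Cov-acyclic vs ne))
        (full-acyclic ne′ _)
        (Cov-acyclic vs ne′))

-- Full simplices, chains and iterated suspensions

powerset : ∀ {n} → Subset n → Complex n
powerset π .Face σ = σ ⊆ π
powerset π .face? σ = σ ⊆? π
powerset π .∅-face = ⊆-min π
powerset π .down-closed = ⊆-trans

-- If `I` meets `π`, the restriction is a cone; otherwise `π` lies in `∁ I`, whose rank is then at
-- least `k`. As `m` is arbitrary, `Cov` formed with `powerset π` is acyclic in every degree over
-- nonempty `I`.
powerset-connected : ∀ {n} (M : Matroid n) k {π} → k ≤ Rank.r M π → ∀ m → Connected M k m (powerset π)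
powerset-connected M k {π} k≤rπ m I _ r<k s _ with nonempty? (π ∩ I)
... | yes (v , v∈) = cone-acyclic (powerset π ↾ I) v
        (λ (σ⊆π , σ⊆I) → ∪-least σ⊆π (⁅⁆⊆ (p∩q⊆p π I v∈)) , ∪-least σ⊆I (⁅⁆⊆ (p∩q⊆q π I v∈))) s
... | no  empty    = contradiction
        (ℕ.≤-trans k≤rπ (Rank.r-mono M λ v∈π → x∉p⇒x∈∁p λ v∈I → empty (_ , x∈p∩q⁺ (v∈π , v∈I)))) (ℕ.<⇒≱ r<k)

chain-minimum : ∀ {n N} (f : Fin N → Subset n) (x : Subset N) → Nonempty x →
  (∀ i j → i ∈ x → j ∈ x → f i ⊆ f j ⊎ f j ⊆ f i) → ∃ λ i → i ∈ x × (∀ j → j ∈ x → f i ⊆ f j)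
chain-minimum f (s ∷ x) ne chain with nonempty? x
... | no x≡∅ = zeroth ne
  where
  zeroth : Nonempty (s ∷ x) → ∃ λ i → i ∈ s ∷ x × (∀ j → j ∈ s ∷ x → f i ⊆ f j)
  zeroth (zero  , 0∈)        = zero , 0∈ , λ { zero _ → id ; (suc j) (there j∈) → contradiction (j , j∈) x≡∅ }
  zeroth (suc i , there i∈)  = contradiction (i , i∈) x≡∅
... | yes ne′ with chain-minimum (f ∘ suc) x ne′ (λ i j i∈ j∈ → chain (suc i) (suc j) (there i∈) (there j∈))
chain-minimum f (outside ∷ x) ne chain | yes ne′ | i , i∈ , least =
  suc i , there i∈ , λ { (suc j) (there j∈) → least j j∈ }
chain-minimum f (inside ∷ x) ne chain | yes ne′ | i , i∈ , least with chain zero (suc i) here (there i∈)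
... | inj₁ f0⊆fi = zero , here , λ { zero _ → id ; (suc j) (there j∈) → ⊆-trans f0⊆fi (least j j∈) }
... | inj₂ fi⊆f0 = suc i , there i∈ , λ { zero _ → fi⊆f0 ; (suc j) (there j∈) → least j j∈ }

-- The pairs (σ , τ) leaving a point of vs uncovered form a sphere of dimension
-- ∣ vs ∣ - 2, so their join with L is an iterated suspension of L.
module Suspension (n : ℕ) {N : ℕ} (L : Complex N) where
  open Coordinates n N

  On : Subset n → List (Fin n) → Set
  On σ vs = ∀ v → v ∈ σ → v ∈ᴸ vs

  on? : ∀ σ vs → Dec (On σ vs)
  on? σ vs = Fin.all? λ v → (v ∈? σ) →-dec Any.any? (v Fin.≟_) vs

  on-∪ : ∀ {σ v vs} → v ∈ᴸ vs → On σ vs → On (σ ∪ ⁅ v ⁆) vs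
  on-∪ {σ} v∈vs on u u∈ = [ on u , (λ { refl → v∈vs }) ]′ (∈∪⁅⁆⁻ σ u∈)

  on-there : ∀ {σ v vs} → On σ vs → On σ (v ∷ vs)
  on-there on u u∈ = there (on u u∈)

  on-avoids : ∀ {σ v vs} → On σ (v ∷ vs) → v ∉ σ → On σ vs
  on-avoids on v∉σ u u∈ with on u u∈
  ... | here refl  = contradiction u∈ v∉σ
  ... | there u∈vs = u∈vs

  Join : List (Fin n) → Family
  Join vs .Holds σ τ x = Face L x × On σ vs × On τ vs
  Join vs .holds? σ τ x = face? L x ×-dec on? σ vs ×-dec on? τ vs
  Join vs .empty = ∅-face L , (λ _ v∈ → contradiction v∈ ∉⊥) , (λ _ v∈ → contradiction v∈ ∉⊥)
  Join vs .down σ⊆ τ⊆ x⊆ (f , on , on′) = down-closed L x⊆ f , (λ v → on v ∘ σ⊆) , (λ v → on′ v ∘ τ⊆)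

  Join-acyclic : ∀ v vs t → Acyclic ⟦ Join (v ∷ vs) ⟧ t
  Join-acyclic v vs = cone₁ (Join (v ∷ vs)) v (λ (f , on , on′) → f , on-∪ (here refl) on , on′)

  -- The pairs live on `us`, and `v ∷ vs` lists the points whose being uncovered counts; the two
  -- lists differ in the cone that appears in `desuspend`. A nonempty second list admits the empty
  -- face.
  Susp : List (Fin n) → ∀ v vs → Family
  Susp us v vs .Holds σ τ x = Holds (Join us) σ τ x × Uncovered σ τ (v ∷ vs)
  Susp us v vs .holds? σ τ x = holds? (Join us) σ τ x ×-dec uncovered? σ τ (v ∷ vs)
  Susp us v vs .empty = empty (Join us) , here (∉⊥ , ∉⊥)
  Susp us v vs .down σ⊆ τ⊆ x⊆ (f , u) = down (Join us) σ⊆ τ⊆ x⊆ f , uncovered-down σ⊆ τ⊆ u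

  -- The complex is the union of a cone with apex `v`, where a point of `w ∷ ws` is uncovered, and a
  -- join with full simplices on `w ∷ ws`, where `v` is uncovered. They meet in the same complex for
  -- `w ∷ ws`, and passing to it costs one degree.
  desuspend : ∀ v vs → Unique (v ∷ vs) → ∀ {t} → Acyclic ⟦ Susp (v ∷ vs) v vs ⟧ (length vs + t) → Acyclic L t
  -- With `v` as the only point and uncovered, `σ` and `τ` are empty, so a copy of `L` remains.
  desuspend v [] _ H = preimage-acyclic
    (image₃ L (Susp (v ∷ []) v [])
      (λ f → (f , (λ _ v∈ → contradiction v∈ ∉⊥) , (λ _ v∈ → contradiction v∈ ∉⊥)) , here (∉⊥ , ∉⊥))
      (λ ((f , _) , _) → f)
      (λ { ((_ , on , on′) , here (v∉σ , v∉τ)) → (λ {u} u∈ → only on v∉σ u u∈) , (λ {u} u∈ → only on′ v∉τ u u∈) }))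
    H
    where
    only : ∀ {σ} → On σ (v ∷ []) → v ∉ σ → ∀ u → u ∈ σ → u ∈ ⊥
    only on v∉σ u u∈ with on-avoids on v∉σ u u∈
    ... | ()
  desuspend v (w ∷ ws) (v∉ws ∷ unique) H = desuspend w ws unique
    (MayerVietoris.intersection
      {K = ⟦ Susp (v ∷ w ∷ ws) v (w ∷ ws) ⟧} {⟦ Susp (v ∷ w ∷ ws) w ws ⟧} {⟦ Join (w ∷ ws) ⟧} {⟦ Susp (w ∷ ws) w ws ⟧}
      (record
        { A⊆K   = λ (f , u) → f , there u
        ; B⊆K   = λ (f , on , on′) → (f , on-there on , on-there on′) , here (outside-on on , outside-on on′)
        ; K⊆A∪B = λ { ((f , on , on′) , here (v∉σ , v∉τ)) → inj₂ (f , on-avoids on v∉σ , on-avoids on′ v∉τ)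
                    ; (f , there u) → inj₁ (f , u) }
        ; I⊆A   = λ ((f , on , on′) , u) → (f , on-there on , on-there on′) , u
        ; I⊆B   = proj₁
        ; A∩B⊆I = λ (_ , u) f → f , u
        })
      H
      (cone₁ (Susp (v ∷ w ∷ ws) w ws) v
        (λ ((f , on , on′) , u) → (f , on-∪ (here refl) on , on′) , still-uncovered u) _)
      (Join-acyclic w ws _))
    where
    outside-on : ∀ {σ} → On σ (w ∷ ws) → v ∉ σ
    outside-on on v∈σ = All.lookup v∉ws (on v v∈σ) refl
    still-uncovered : ∀ {σ τ} → Uncovered σ τ (w ∷ ws) → Uncovered (σ ∪ ⁅ v ⁆) τ (w ∷ ws)
    still-uncovered {σ} u with find u
    ... | y , y∈ws , y∉σ , y∉τ = lose y∈ws
      ((λ y∈ → [ y∉σ , (λ { refl → All.lookup v∉ws y∈ws refl }) ]′ (∈∪⁅⁆⁻ σ y∈)) , y∉τ)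

-- The complex of triples and its comparison with Int

module Comparison {n : ℕ} (C : Complex (suc n)) (M : Matroid (suc n)) (k : ℕ) (k≤r⊤ : k ≤ Rank.r M ⊤)
  (P : List (Subset (suc n))) (∈P⁻ : ∀ {σ} → σ ∈ᴸ P → Face C σ × k ≤ Rank.r M σ)
  (∈P⁺ : ∀ {σ} → Face C σ → k ≤ Rank.r M σ → σ ∈ᴸ P) where
  open Rank M

  N : ℕ
  N = length P

  -- The membership hypotheses say that `P` lists the simplices of `C` of rank at least `k`; in the
  -- application `L` is `Int≤ C M k`.
  L : Complex N
  L = chainComplex P

  open Coordinates (suc n) N

  vs : List (Fin (suc n))
  vs = allFin (suc n)

  Below : Subset (suc n) → Subset (suc n) → Subset N → Set
  Below σ τ x = Face C σ × k ≤ r (∁ τ) × (∀ i → i ∈ x → σ ⊆ lookup P i)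

  -- Over x = ∅ this is Cov ⊤ vs; its faces with an uncovered point form the
  -- join of L with a sphere.
  T : Family
  T .Holds σ τ x = Face L x × (Below σ τ x ⊎ Uncovered σ τ vs)
  T .holds? σ τ x = face? L x ×-dec
    ((face? C σ ×-dec (k ≤? r (∁ τ)) ×-dec Fin.all? (λ i → (i ∈? x) →-dec (σ ⊆? lookup P i))) ⊎-dec uncovered? σ τ vs)
  T .empty = ∅-face L , inj₂ (here (∉⊥ , ∉⊥))
  T .down σ⊆ τ⊆ x⊆ (f , inj₁ (σ∈C , k≤r , below)) = down-closed L x⊆ f ,
    inj₁ (down-closed C σ⊆ σ∈C , ℕ.≤-trans k≤r (r-mono (∁-anti τ⊆)) , λ i i∈x → ⊆-trans σ⊆ (below i (x⊆ i∈x)))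
  T .down σ⊆ τ⊆ x⊆ (f , inj₂ u) = down-closed L x⊆ f , inj₂ (uncovered-down σ⊆ τ⊆ u)

  as : List (Fin G)
  as = map ι₃ (allFin N)

  avoids-as⇒ : ∀ {S} → All (_∉ S) as → pr₃ S ⊆ ⊥
  avoids-as⇒ as∉S {i} i∈ = contradiction (∈-preimage⁻ ι₃ i∈) (All.lookup as∉S (∈-map⁺ ι₃ (∈-allFin i)))

  ⇒avoids-as : ∀ {S} → pr₃ S ⊆ ⊥ → All (_∉ S) as
  ⇒avoids-as {S} empty = All.tabulate λ a∈ a∈S → let i , _ , eq = ∈-map⁻ ι₃ a∈ in
    ∉⊥ (empty (∈-preimage⁺ ι₃ (subst (_∈ S) eq a∈S)))

  -- The fibre lemma is applied to the vertices of `L`: without them `⟦ T ⟧` is `⟦ Cov ⊤ vs ⟧`, and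
  -- the fibre over a nonempty chain is this complex with a full simplex in place of `C`.
  T-acyclic : ∀ {m} → Connected M k m C → Acyclic ⟦ T ⟧ (suc n + m)
  T-acyclic {m} connected = acyclic-fibres as ⟦ T ⟧
    (acyclic-resp {K = ⟦ Cov ⊤ vs ⟧} {deletions ⟦ T ⟧ as}
      (λ { ((_ , _ , x⊆⊥) , inj₁ (σ∈C , k≤r)) →
             (down-closed L x⊆⊥ (∅-face L) , inj₁ (σ∈C , k≤r , λ i i∈ → contradiction (x⊆⊥ i∈) ∉⊥)) , ⇒avoids-as x⊆⊥
         ; ((_ , _ , x⊆⊥) , inj₂ u) → (down-closed L x⊆⊥ (∅-face L) , inj₂ u) , ⇒avoids-as x⊆⊥ })
      (λ { ((_ , inj₁ (σ∈C , k≤r , _)) , as∉S) → (⊆-max _ , ⊆-max _ , avoids-as⇒ as∉S) , inj₁ (σ∈C , k≤r)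
         ; ((_ , inj₂ u) , as∉S) → (⊆-max _ , ⊆-max _ , avoids-as⇒ as∉S) , inj₂ u })
      (subst (λ e → Acyclic ⟦ Cov ⊤ vs ⟧ (e + m)) (∣⊤∣≡n (suc n)) (Cov-acyclic vs (zero , ∈⊤))))
    fibre
    where
    open Covering N M k k≤r⊤ C m connected
    fibre : ∀ {x} (x∈T : Face ⟦ T ⟧ x) → Nonempty x → (∀ {a} → a ∈ x → a ∈ᴸ as) →
            ∀ s → Acyclic (deletions (closedStar ⟦ T ⟧ x∈T) as) s
    fibre {x} x∈T (a , a∈x) x⊆as s = over (chain-minimum (lookup P) (pr₃ x) nonempty (proj₁ x∈T))
      where
      nonempty : Nonempty (pr₃ x)
      nonempty = let i , _ , eq = ∈-map⁻ ι₃ (x⊆as a∈x) in i , ∈-preimage⁺ ι₃ (subst (_∈ x) eq a∈x)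
      over : (∃ λ i → i ∈ pr₃ x × (∀ j → j ∈ pr₃ x → lookup P i ⊆ lookup P j)) →
             Acyclic (deletions (closedStar ⟦ T ⟧ x∈T) as) s
      over (i , i∈x , least) = acyclic-resp
          {K = ⟦ Simplex.Cov ⊤ vs ⟧} {deletions (closedStar ⟦ T ⟧ x∈T) as} to from
          (acyclic-≤ {K = ⟦ Simplex.Cov ⊤ vs ⟧} (ℕ.m≤n+m s _) (Simplex.Cov-acyclic vs (zero , ∈⊤)))
        where
        -- The least member of the chain: `σ` lies in every member exactly when it lies in `π`.
        π : Subset (suc n)
        π = lookup P i
        -- The value `s` is chosen for `m`, so that the bound reaches the required degree.
        module Simplex = Covering N M k k≤r⊤ (powerset π) s (powerset-connected M k (proj₂ (∈P⁻ (∈-lookup i))) s)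
        drop₁ : ∀ S → pr₁ (S ∪ x) ⊆ pr₁ S
        drop₁ = preimage-∪-disjoint ι₁ λ v v∈x → let j , _ , eq = ∈-map⁻ ι₃ (x⊆as v∈x) in ι₁≢ι₃ v j eq
        drop₂ : ∀ S → pr₂ (S ∪ x) ⊆ pr₂ S
        drop₂ = preimage-∪-disjoint ι₂ λ v v∈x → let j , _ , eq = ∈-map⁻ ι₃ (x⊆as v∈x) in ι₂≢ι₃ v j eq
        drop₃ : ∀ S → pr₃ S ⊆ ⊥ → pr₃ (S ∪ x) ⊆ pr₃ x
        drop₃ S empty = ⊆-trans (preimage-∪ ι₃ S x) (∪-least (⊆-trans empty (⊆-min _)) id)
        to : ∀ {S} → Face ⟦ Simplex.Cov ⊤ vs ⟧ S → Face (deletions (closedStar ⟦ T ⟧ x∈T) as) S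
        to {S} ((_ , _ , empty) , h) = down T (drop₁ S) (drop₂ S) (drop₃ S empty) (proj₁ x∈T , h′ h) , ⇒avoids-as empty
          where
          h′ : (pr₁ S ⊆ π × k ≤ r (∁ (pr₂ S))) ⊎ Uncovered (pr₁ S) (pr₂ S) vs →
               Below (pr₁ S) (pr₂ S) (pr₃ x) ⊎ Uncovered (pr₁ S) (pr₂ S) vs
          h′ (inj₁ (σ⊆π , k≤r)) = inj₁ (down-closed C σ⊆π (proj₁ (∈P⁻ (∈-lookup i))) , k≤r , λ j j∈ → ⊆-trans σ⊆π (least j j∈))
          h′ (inj₂ u)           = inj₂ u
        from : ∀ {S} → Face (deletions (closedStar ⟦ T ⟧ x∈T) as) S → Face ⟦ Simplex.Cov ⊤ vs ⟧ S
        from {S} ((_ , h) , as∉S) = (⊆-max _ , ⊆-max _ , avoids-as⇒ as∉S) , h′ h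
          where
          h′ : Below (pr₁ (S ∪ x)) (pr₂ (S ∪ x)) (pr₃ (S ∪ x)) ⊎ Uncovered (pr₁ (S ∪ x)) (pr₂ (S ∪ x)) vs →
               (pr₁ S ⊆ π × k ≤ r (∁ (pr₂ S))) ⊎ Uncovered (pr₁ S) (pr₂ S) vs
          h′ (inj₁ (_ , k≤r , below)) = inj₁
            (⊆-trans (preimage-mono ι₁ (p⊆p∪q x)) (below i (preimage-mono ι₃ (q⊆p∪q S x) i∈x)) ,
             ℕ.≤-trans k≤r (r-mono (∁-anti (preimage-mono ι₂ (p⊆p∪q x)))))
          h′ (inj₂ u) = inj₂ (uncovered-down (preimage-mono ι₁ (p⊆p∪q x)) (preimage-mono ι₂ (p⊆p∪q x)) u)

  -- The vertices of the first two copies, so that the trace of a face on `B` records its pair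
  -- `(σ , τ)`.
  B : Subset G
  B = ∁ (image θ₃ ⊤)

  ι₁∈B : ∀ v → ι₁ v ∈ B
  ι₁∈B v = x∉p⇒x∈∁p λ v∈ → let i , _ , eq = ∈-image⁻ θ₃ ⊤ v∈ in ι₁≢ι₃ v i (trans eq (embed-θ₃ i))

  ι₂∈B : ∀ v → ι₂ v ∈ B
  ι₂∈B v = x∉p⇒x∈∁p λ v∈ → let i , _ , eq = ∈-image⁻ θ₃ ⊤ v∈ in ι₂≢ι₃ v i (trans eq (embed-θ₃ i))

  ι₃∉B : ∀ i → ι₃ i ∉ B
  ι₃∉B i = x∈p⇒x∉∁p (subst (_∈ image θ₃ ⊤) (embed-θ₃ i) (∈-image⁺ θ₃ {σ = ⊤} ∈⊤))

  Covers : Subset G → Set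
  Covers S = ¬ Uncovered (pr₁ S) (pr₂ S) vs

  covers-up : ∀ {S S′} → S ⊆ S′ → Covers S → Covers S′
  covers-up S⊆S′ cov u = cov (uncovered-down (preimage-mono ι₁ S⊆S′) (preimage-mono ι₂ S⊆S′) u)

  covers-trace : ∀ {S} → Covers S → Covers (S ∩ B)
  covers-trace cov u = cov (uncovered-down
    (λ {v} v∈ → ∈-preimage⁺ ι₁ (x∈p∩q⁺ (∈-preimage⁻ ι₁ v∈ , ι₁∈B v)))
    (λ {v} v∈ → ∈-preimage⁺ ι₂ (x∈p∩q⁺ (∈-preimage⁻ ι₂ v∈ , ι₂∈B v))) u)

  covering-below : ∀ {S} → Face ⟦ T ⟧ S → Covers S → Below (pr₁ S) (pr₂ S) (pr₃ S)
  covering-below (_ , inj₁ b) _   = b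
  covering-below (_ , inj₂ u) cov = contradiction u cov

  -- The simplices of T over a covering (σ , τ) form a cone whose apex is the
  -- vertex σ of Int: the complement of τ is spanning and contained in σ.
  apex : ∀ {s} → Face ⟦ T ⟧ s → Covers s → s ⊆ B →
    ∃ λ a → a ∉ B × (∀ {S} → S ∩ B ⊆ s → Face ⟦ T ⟧ (S ∪ s) → Face ⟦ T ⟧ ((S ∪ ⁅ a ⁆) ∪ s))
  apex {s} s∈T cov _ = cone-point (covering-below {s} s∈T cov)
    where
    ∁τ⊆σ : ∁ (pr₂ s) ⊆ pr₁ s
    ∁τ⊆σ {v} v∈ with v ∈? pr₁ s
    ... | yes v∈σ = v∈σ
    ... | no  v∉σ = contradiction (lose (∈-allFin v) (v∉σ , x∈∁p⇒x∉p v∈)) cov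
    cone-point : Below (pr₁ s) (pr₂ s) (pr₃ s) →
      ∃ λ a → a ∉ B × (∀ {S} → S ∩ B ⊆ s → Face ⟦ T ⟧ (S ∪ s) → Face ⟦ T ⟧ ((S ∪ ⁅ a ⁆) ∪ s))
    cone-point (σ∈C , k≤r , _) =
      let σ∈P = ∈P⁺ σ∈C (ℕ.≤-trans k≤r (r-mono ∁τ⊆σ)); i = Any.index σ∈P in
      ι₃ i , ι₃∉B i , λ {S} → closed i (sym (lookup-index σ∈P)) {S}
      where
      closed : ∀ i → lookup P i ≡ pr₁ s →
        ∀ {S} → S ∩ B ⊆ s → Face ⟦ T ⟧ (S ∪ s) → Face ⟦ T ⟧ ((S ∪ ⁅ ι₃ i ⁆) ∪ s)
      closed i Pi≡σ {S} S∩B⊆s f = down T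
        (shrink ι₁ (λ v → ι₁≢ι₃ v i)) (shrink ι₂ (λ v → ι₂≢ι₃ v i)) grow
        (chain , inj₁ (proj₁ S∪s-below , proj₁ (proj₂ S∪s-below) , below′))
        where
        S∪s-below : Below (pr₁ (S ∪ s)) (pr₂ (S ∪ s)) (pr₃ (S ∪ s))
        S∪s-below = covering-below {S ∪ s} f (covers-up (q⊆p∪q S s) cov)
        x : Subset N
        x = pr₃ (S ∪ s)
        swap : (S ∪ ⁅ ι₃ i ⁆) ∪ s ⊆ (S ∪ s) ∪ ⁅ ι₃ i ⁆
        swap = ∪-least (∪-mono (p⊆p∪q s) id) (⊆-trans (q⊆p∪q S s) (p⊆p∪q ⁅ ι₃ i ⁆))
        shrink : ∀ (ι : Fin (suc n) → Fin G) → (∀ v → ι v ≢ ι₃ i) → preimage ι ((S ∪ ⁅ ι₃ i ⁆) ∪ s) ⊆ preimage ι (S ∪ s)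
        shrink ι ≢i = ⊆-trans (preimage-mono ι swap) (preimage-∪⁅⁆-disjoint ι ≢i (S ∪ s))
        grow : pr₃ ((S ∪ ⁅ ι₃ i ⁆) ∪ s) ⊆ x ∪ ⁅ i ⁆
        grow = ⊆-trans (preimage-mono ι₃ swap) (preimage-∪⁅⁆ ι₃ ι₃-injective (S ∪ s) i)
        -- `S` adds no point of `B` to `s`, so `S ∪ s` has the same first component as `s`.
        σ′⊆Pi : pr₁ (S ∪ s) ⊆ lookup P i
        σ′⊆Pi {v} v∈ = subst (v ∈_) (sym Pi≡σ) (∈-preimage⁺ ι₁ ([ (λ v∈S → S∩B⊆s (x∈p∩q⁺ (v∈S , ι₁∈B v))) , id ]′
          (x∈p∪q⁻ S s (∈-preimage⁻ ι₁ v∈))))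
        Pi⊆σ′ : lookup P i ⊆ pr₁ (S ∪ s)
        Pi⊆σ′ {v} v∈ = preimage-mono ι₁ (q⊆p∪q S s) (subst (v ∈_) Pi≡σ v∈)
        below′ : ∀ j → j ∈ x ∪ ⁅ i ⁆ → pr₁ (S ∪ s) ⊆ lookup P j
        below′ j j∈ with ∈∪⁅⁆⁻ x j∈
        ... | inj₁ j∈x  = proj₂ (proj₂ S∪s-below) j j∈x
        ... | inj₂ refl = σ′⊆Pi
        -- The new vertex is `σ` itself; it is contained in every member of `x` and hence comparable
        -- with all of them.
        chain : Face L (x ∪ ⁅ i ⁆)
        chain j j′ j∈ j′∈ with ∈∪⁅⁆⁻ x j∈ | ∈∪⁅⁆⁻ x j′∈
        ... | inj₁ j∈x  | inj₁ j′∈x = proj₁ f j j′ j∈x j′∈x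
        ... | inj₂ refl | _         = inj₁ (⊆-trans Pi⊆σ′ (below′ j′ j′∈))
        ... | _         | inj₂ refl = inj₂ (⊆-trans Pi⊆σ′ (below′ j j∈))

  open BadFaces ⟦ T ⟧ B {Covers} (λ S → ¬? (uncovered? (pr₁ S) (pr₂ S) vs))
    (λ {S} {S′} → covers-up {S} {S′}) (λ {S} → covers-trace {S})
    -- The ground set has a point, which the empty pair leaves uncovered.
    (λ cov → cov (here (∉⊥ ∘ preimage-⊥ ι₁ , ∉⊥ ∘ preimage-⊥ ι₂))) (λ {s} → apex {s})

  -- The good faces of `⟦ T ⟧` form `⟦ Susp vs zero ws ⟧`. Desuspending once for each of the `n`
  -- points of `ws` turns the bound `suc n + m` into `m + 1`.
  Int-acyclic : ∀ {m} → Connected M k m C → Acyclic L (m + 1)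
  Int-acyclic {m} connected = desuspend zero ws (allFin⁺ (suc n))
    (subst (Acyclic ⟦ Susp vs zero ws ⟧) bound
      (acyclic-resp {K = good} {⟦ Susp vs zero ws ⟧}
        (λ {S} ((f , _) , ¬cov) → (f , (λ v _ → ∈-allFin v) , (λ v _ → ∈-allFin v)) ,
          decidable-stable (uncovered? (pr₁ S) (pr₂ S) vs) ¬cov)
        (λ ((f , _) , u) → (f , inj₂ u) , λ cov → cov u)
        (good-acyclic (T-acyclic connected))))
    where
    open Suspension (suc n) L
    ws : List (Fin (suc n))
    ws = List.tabulate suc
    bound : suc n + m ≡ length ws + (m + 1)
    bound = trans (cong suc (ℕ.+-comm n m)) (trans (cong (_+ n) (ℕ.+-comm 1 m))
      (trans (ℕ.+-comm (m + 1) n) (cong (_+ (m + 1)) (sym (length-tabulate {n = n} (λ v → Fin.suc v))))))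

-- From bounds on the connectivity parameter to vanishing homology

+∞-cancel : ∀ {s b c} {e : ℕ∞} → [ c ] ≤∞ e +∞ b → s + b ≤ c → [ s ] ≤∞ e
+∞-cancel {s} {b} {e = [ e ]} [ c≤e+b ]≤ s+b≤c = [ ℕ.+-cancelʳ-≤ b s e (ℕ.≤-trans s+b≤c c≤e+b) ]≤
+∞-cancel {s} {e = ⊤⁺} _ _ = [ s ] ≤⊤∞

theorem5p6 : ∀ {n : ℕ} (C : Complex n) (M : Matroid n) (k m : ℕ) → 1 ≤ k → k ≤ rank M →
    (∀ (X : Subset n) → IsFlat M (∁ X) → rank (M ↾ᴹ ∁ X) ≤ k ∸ 1 →
    [ k + m ] ≤∞ ηH (C ↾ X) +∞ rank (M ↾ᴹ ∁ X)) →
    [ m + 1 ] ≤∞ ηH (Int≤ C M k)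
-- On an empty ground set the rank is 0, against `1 ≤ k`.
theorem5p6 {zero} C M k m 1≤k k≤rank hyp with rank-attained M
... | A , _ , ∣A∣≡rank = contradiction
  (ℕ.≤-trans (ℕ.≤-trans 1≤k k≤rank) (subst (_≤ 0) ∣A∣≡rank (∣p∣≤n A))) λ ()
theorem5p6 {suc n} C M k m 1≤k k≤rank hyp = Equivalence.from (ηH-spec (Int≤ C M k) (m + 1))
  (Comparison.Int-acyclic C M k (ℕ.≤-trans k≤rank rank≤r⊤) (IntVertices C (truncate M k))
    (λ σ∈P → let _ , σ∈C , basis = ∈-filter⁻ vertex? {xs = subsets (suc n)} σ∈P in
      σ∈C , containsBasis⇒spans k≤rank basis)
    (λ {σ} σ∈C k≤r → ∈-filter⁺ vertex? (∈-subsets σ) (σ∈C , spans⇒containsBasis k≤r))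
    λ I flat r<k s s+r≤k+m →
      Equivalence.to (ηH-spec (C ↾ I) s) (+∞-cancel (hyp I flat (ℕ.pred-mono-≤ r<k)) s+r≤k+m))
  where
  open Rank M
  vertex? : Decidable (λ σ → Face C σ × ContainsBasis (truncate M k) σ)
  vertex? σ = face? C σ ×-dec containsBasis? (truncate M k) σ
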